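{- There exist a finite abelian group $G_0$ and a finite non-empty subset $F$ of $\mathbb{Z}^2 \times G_0$ such that the tiling equation $A \oplus F = \mathbb{Z}^2 \times G_0$ is aperiodic.
   Context: Let $G$ be a discrete abelian group and $A,F\subset G$. We write $A \oplus F = G$ if the translates $a+F=\{a+f: f\in F\}$, $a\in A$, are pairwise disjoint and their union is $G$. A set $A\subset G$ is called periodic if it is a finite union of cosets of a finite-index subgroup of $G$. The tiling equation $A\oplus F=G$ (with $F,G$ given and $A$ unknown) is called aperiodic if there exists at least one $A\subset G$ with $A\oplus F=G$, but no such $A$ is periodic. -}

module Defs where

open import Level using (0ℓ)
open import Data.Empty using (⊥)
open import Algebra.Bundles using (AbelianGroup)
open import Data.Nat using (ℕ)
open import Data.Fin using (Fin)
open import Data.Integer as ℤ using (ℤ)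
open import Data.Product using (Σ; ∃; ∃-syntax; _×_; _,_)
open import Data.List using (List)
open import Data.List.Membership.Propositional using (_∈_)
open import Function.Bundles using (_↔_)
open import Relation.Binary.PropositionalEquality using (_≡_)

record FiniteAbelianGroup : Set₁ where
  field
    abGroup : AbelianGroup 0ℓ 0ℓ
  open AbelianGroup abGroup public
  field
    ≈⇒≡   : ∀ {x y} → x ≈ y → x ≡ y
    size  : ℕ
    enum  : Fin size ↔ Carrier

module Ambient (G₀ : FiniteAbelianGroup) where
  private
    module G₀ = FiniteAbelianGroup G₀

  G : Set
  G = ℤ × ℤ × G₀.Carrier

  _+ᴳ_ : G → G → G
  (a , b , x) +ᴳ (c , d , y) = (a ℤ.+ c , b ℤ.+ d , x G₀.∙ y)

  -ᴳ_ : G → G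
  -ᴳ (a , b , x) = (ℤ.- a , ℤ.- b , x G₀.⁻¹)

  0ᴳ : G
  0ᴳ = (ℤ.0ℤ , ℤ.0ℤ , G₀.ε)

  _-ᴳ_ : G → G → G
  g -ᴳ h = g +ᴳ (-ᴳ h)

  Subset : Set₁
  Subset = G → Set

  Tiles : Subset → List G → Set
  Tiles A F =
    (∀ g → ∃[ a ] ∃[ f ] (A a × f ∈ F × a +ᴳ f ≡ g))
    × (∀ a a′ f f′ → A a → A a′ → f ∈ F → f′ ∈ F → a +ᴳ f ≡ a′ +ᴳ f′ → a ≡ a′)

  IsSubgroup : Subset → Set
  IsSubgroup H = H 0ᴳ × (∀ g h → H g → H h → H (g +ᴳ h)) × (∀ g → H g → H (-ᴳ g))

  FiniteIndex : Subset → Set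
  FiniteIndex H = ∃[ R ] (∀ g → ∃[ r ] (r ∈ R × H (g -ᴳ r)))

  Periodic : Subset → Set₁
  Periodic A = ∃[ H ] (IsSubgroup H × FiniteIndex H ×
                 ∃[ L ] (∀ g → (A g → ∃[ r ] (r ∈ L × H (g -ᴳ r)))
                             × (∃[ r ] (r ∈ L × H (g -ᴳ r)) → A g)))

  Aperiodic : List G → Set₁
  Aperiodic F = (∃[ A ] Tiles A F) × (∀ A → Tiles A F → Periodic A → ⊥)

{-# OPTIONS --safe #-}
module Submission where

-- Encoding.  A tiling of ℤ² × F₂ⁿ × V by {0} × {0} × V is the graph of a map φ : ℤ² × F₂ⁿ → V, and
-- further tiling equations constrain φ.  For V = F₂ⁿ × Z₄ and φ = (f , w), put b(x) = f(x , 1) − f(x , 0).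
-- Tiling equations can force a bit of b to be constant in a given direction, can force (using w) one
-- bit to alternate horizontally, and can forbid any given value of b; so they express any pointwise
-- constraint on b.  Several tiling equations are merged into one by adding a factor Z₅: if F₁ × {0, 1}
-- ∪ F₂ × {2, 3, 4} tiles, then over every point of G there is exactly one piece of each kind, because
-- 2a + 3b = 5 only for a = b = 1.
--
-- Aperiodic constraint.  Consider functions of the forms m, n, m + n, m + 16n, n + 16m, m − 15n on ℤ²
-- that satisfy the local relations holding for the last nonzero base 16 digits of these forms.  If
-- A, B, C (the functions of m, n, m + n) agree with a homomorphism ρ to Z₁₆ wherever it does not vanish,
-- then with F(t) = ρ(t) − A(16t) and G(u) the analogue for m + 16n the relations give, for ρ(t) ≠ ρ(u),
-- that G(u) = F(t), G(u) = ρ(t) or F(t) = ρ(u).  A majority argument then shows that F is constant where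
-- ρ differs from this constant, so after rescaling by 16 the same situation recurs.  A period of A is thus
-- divisible by every power of 16.  Clocks modulo 16, forced by the alternating bit, start the descent; the
-- digits of 3m + 1, 3n + 1, … give a solution.

open import Defs
open import Level using (0ℓ)
open import Algebra.Bundles using (AbelianGroup)
import Algebra.Properties.Group as GroupProperties
open import Data.Bool using (Bool; true; false; not; _∧_; _xor_; if_then_else_)
import Data.Bool.Properties as Boolₚ
open import Data.Empty using (⊥; ⊥-elim)
open import Data.Fin as Fin using (Fin; zero; suc; toℕ)
open import Data.Fin.Patterns
import Data.Fin.Properties as Finₚ
open import Data.Integer as ℤ using (ℤ; +_; 0ℤ; 1ℤ)
open import Data.Integer.DivMod using (_%ℕ_; _/ℕ_; a≡a%ℕn+[a/ℕn]*n; n%ℕd<d)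
import Data.Integer.Properties as ℤₚ
open import Data.Integer.Tactic.RingSolver using (solve-∀)
open import Data.List as List using (List; []; _∷_; map; allFin; _++_; cartesianProductWith; concatMap; filter; length)
open import Data.List.Membership.DecPropositional (Finₚ._≟_ {5}) using (_∈?_)
open import Data.List.Membership.Propositional using (_∈_; _∉_; find; lose)
open import Data.List.Membership.Propositional.Properties
open import Data.List.Properties using (length-map)
open import Data.List.Relation.Unary.All as All using (All; []; _∷_)
import Data.List.Relation.Unary.All.Properties as Allₚ
open import Data.List.Relation.Unary.Any using (here; there; index)
open import Data.List.Relation.Unary.Any.Properties using (lookup-index)
open import Data.Nat as ℕ using (ℕ; zero; suc; NonZero; _%_)
open import Data.Nat.Divisibility using (_∣_; _∣?_; divides)
import Data.Nat.DivMod as DivMod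
open import Data.Nat.Induction using (<-wellFounded)
import Data.Nat.Properties as ℕₚ
open import Data.Product using (∃-syntax; _×_; _,_; proj₁; proj₂)
open import Data.Product.Function.NonDependent.Propositional using (_×-↔_)
open import Data.Sum using (_⊎_; inj₁; inj₂)
open import Data.Unit using (⊤; tt)
open import Data.Vec as Vec using (Vec; []; _∷_; lookup)
import Data.Vec.Properties as Vecₚ
open import Function using (_∘_; id)
open import Function.Bundles using (_↔_; Inverse; mk↔ₛ′)
open import Function.Construct.Composition using (_↔-∘_)
open import Induction.WellFounded using (Acc; acc)
open import Relation.Binary.PropositionalEquality
open import Relation.Nullary using (¬_; Dec; yes; no; ¬?)
open import Relation.Nullary.Decidable using (from-yes; _×-dec_; _⊎-dec_; _→-dec_; map′; ⌊_⌋; decidable-stable)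

-- Finite abelian groups

abelianGroup : (C : Set) (_∙_ : C → C → C) (ε : C) (_⁻¹ : C → C) →
  (∀ x y z → (x ∙ y) ∙ z ≡ x ∙ (y ∙ z)) → (∀ x y → x ∙ y ≡ y ∙ x) →
  (∀ x → ε ∙ x ≡ x) → (∀ x → (x ⁻¹) ∙ x ≡ ε) → AbelianGroup 0ℓ 0ℓ
abelianGroup C _∙_ ε _⁻¹ assoc comm identityˡ inverseˡ = record
  { Carrier = C ; _≈_ = _≡_ ; _∙_ = _∙_ ; ε = ε ; _⁻¹ = _⁻¹
  ; isAbelianGroup = record
    { isGroup = record
      { isMonoid = record
        { isSemigroup = record
          { isMagma = record { isEquivalence = isEquivalence ; ∙-cong = cong₂ _∙_ }
          ; assoc = assoc }
        ; identity = identityˡ , λ x → trans (comm x ε) (identityˡ x) }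
      ; inverse = inverseˡ , λ x → trans (comm x (x ⁻¹)) (inverseˡ x)
      ; ⁻¹-cong = cong _⁻¹ }
    ; comm = comm } }

-- The same operations with `_≡_` as the equivalence, since `Tiles` compares points up to `_≡_`.
strict : FiniteAbelianGroup → AbelianGroup 0ℓ 0ℓ
strict G = abelianGroup Carrier _∙_ ε _⁻¹
  (λ x y z → ≈⇒≡ (assoc x y z)) (λ x y → ≈⇒≡ (comm x y))
  (λ x → ≈⇒≡ (identityˡ x)) (λ x → ≈⇒≡ (inverseˡ x))
  where open FiniteAbelianGroup G using (Carrier; _∙_; ε; _⁻¹; ≈⇒≡; assoc; comm; identityˡ; inverseˡ)

elements : (G : FiniteAbelianGroup) → List (FiniteAbelianGroup.Carrier G)
elements G = map (Inverse.to enum) (allFin size)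
  where open FiniteAbelianGroup G using (enum; size)

∈-elements : ∀ G x → x ∈ elements G
∈-elements G x = subst (_∈ elements G) (Inverse.inverseˡ enum refl)
  (∈-map⁺ (Inverse.to enum) (∈-allFin (Inverse.from enum x)))
  where open FiniteAbelianGroup G using (enum)

infixr 6 _⊗_

_⊗_ : FiniteAbelianGroup → FiniteAbelianGroup → FiniteAbelianGroup
G ⊗ H = record
  { abGroup = abelianGroup (G.Carrier × H.Carrier)
      (λ (a , b) (c , d) → a G.∙ c , b H.∙ d) (G.ε , H.ε) (λ (a , b) → a G.⁻¹ , b H.⁻¹)
      (λ _ _ _ → cong₂ _,_ (Gₛ.assoc _ _ _) (Hₛ.assoc _ _ _))
      (λ _ _ → cong₂ _,_ (Gₛ.comm _ _) (Hₛ.comm _ _))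
      (λ _ → cong₂ _,_ (Gₛ.identityˡ _) (Hₛ.identityˡ _))
      (λ _ → cong₂ _,_ (Gₛ.inverseˡ _) (Hₛ.inverseˡ _))
  ; ≈⇒≡ = id
  ; size = G.size ℕ.* H.size
  ; enum = (G.enum ×-↔ H.enum) ↔-∘ Finₚ.*↔× }
  where
  module G = FiniteAbelianGroup G
  module H = FiniteAbelianGroup H
  module Gₛ = AbelianGroup (strict G)
  module Hₛ = AbelianGroup (strict H)

module _ (n : ℕ) .{{_ : NonZero n}} where

  private
    infixl 6 _⊕_
    _⊕_ : Fin n → Fin n → Fin n
    i ⊕ j = (toℕ i ℕ.+ toℕ j) DivMod.mod n

    toℕ-mod : ∀ m → toℕ (m DivMod.mod n) ≡ m % n
    toℕ-mod m = Finₚ.toℕ-fromℕ< _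

    %-+ˡ : ∀ a b → (a % n ℕ.+ b) % n ≡ (a ℕ.+ b) % n
    %-+ˡ a b = begin
      (a % n ℕ.+ b) % n          ≡⟨ DivMod.%-distribˡ-+ (a % n) b n ⟩
      (a % n % n ℕ.+ b % n) % n  ≡⟨ cong (λ c → (c ℕ.+ b % n) % n) (DivMod.m%n%n≡m%n a n) ⟩
      (a % n ℕ.+ b % n) % n      ≡⟨ DivMod.%-distribˡ-+ a b n ⟨
      (a ℕ.+ b) % n              ∎
      where open ≡-Reasoning

    ⊕-comm : ∀ i j → i ⊕ j ≡ j ⊕ i
    ⊕-comm i j = cong (DivMod._mod n) (ℕₚ.+-comm (toℕ i) (toℕ j))

    toℕ-⊕-⊕ : ∀ i j k → toℕ ((i ⊕ j) ⊕ k) ≡ (toℕ i ℕ.+ toℕ j ℕ.+ toℕ k) % n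
    toℕ-⊕-⊕ i j k = trans (toℕ-mod _)
      (trans (cong (λ c → (c ℕ.+ toℕ k) % n) (toℕ-mod _)) (%-+ˡ (toℕ i ℕ.+ toℕ j) (toℕ k)))

    ⊕-assoc : ∀ i j k → (i ⊕ j) ⊕ k ≡ i ⊕ (j ⊕ k)
    ⊕-assoc i j k = trans (Finₚ.toℕ-injective (begin
      toℕ ((i ⊕ j) ⊕ k)                    ≡⟨ toℕ-⊕-⊕ i j k ⟩
      (toℕ i ℕ.+ toℕ j ℕ.+ toℕ k) % n      ≡⟨ cong (_% n) (ℕₚ.+-assoc (toℕ i) (toℕ j) (toℕ k)) ⟩
      (toℕ i ℕ.+ (toℕ j ℕ.+ toℕ k)) % n    ≡⟨ cong (_% n) (ℕₚ.+-comm (toℕ i) (toℕ j ℕ.+ toℕ k)) ⟩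
      (toℕ j ℕ.+ toℕ k ℕ.+ toℕ i) % n      ≡⟨ toℕ-⊕-⊕ j k i ⟨
      toℕ ((j ⊕ k) ⊕ i)                    ∎)) (⊕-comm (j ⊕ k) i)
      where open ≡-Reasoning

    ⊕-identityˡ : ∀ i → (0 DivMod.mod n) ⊕ i ≡ i
    ⊕-identityˡ i = Finₚ.toℕ-injective (begin
      toℕ ((0 DivMod.mod n) ⊕ i)               ≡⟨ toℕ-mod _ ⟩
      (toℕ (0 DivMod.mod n) ℕ.+ toℕ i) % n     ≡⟨ cong (λ c → (c ℕ.+ toℕ i) % n) (trans (toℕ-mod 0) (DivMod.m*n%n≡0 0 n)) ⟩
      toℕ i % n                                ≡⟨ DivMod.m<n⇒m%n≡m (Finₚ.toℕ<n i) ⟩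
      toℕ i                                    ∎)
      where open ≡-Reasoning

    ⊖_ : Fin n → Fin n
    ⊖ i = (n ℕ.∸ toℕ i) DivMod.mod n

    ⊕-inverseˡ : ∀ i → (⊖ i) ⊕ i ≡ 0 DivMod.mod n
    ⊕-inverseˡ i = Finₚ.toℕ-injective (begin
      toℕ ((⊖ i) ⊕ i)                    ≡⟨ toℕ-mod _ ⟩
      (toℕ (⊖ i) ℕ.+ toℕ i) % n          ≡⟨ cong (λ c → (c ℕ.+ toℕ i) % n) (toℕ-mod _) ⟩
      ((n ℕ.∸ toℕ i) % n ℕ.+ toℕ i) % n  ≡⟨ %-+ˡ (n ℕ.∸ toℕ i) (toℕ i) ⟩
      (n ℕ.∸ toℕ i ℕ.+ toℕ i) % n        ≡⟨ cong (_% n) (ℕₚ.m∸n+n≡m (ℕₚ.<⇒≤ (Finₚ.toℕ<n i))) ⟩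
      n % n                              ≡⟨ DivMod.n%n≡0 n ⟩
      0                                  ≡⟨ trans (toℕ-mod 0) (DivMod.m*n%n≡0 0 n) ⟨
      toℕ (0 DivMod.mod n)               ∎)
      where open ≡-Reasoning

  cyclic : FiniteAbelianGroup
  cyclic = record
    { abGroup = abelianGroup (Fin n) _⊕_ (0 DivMod.mod n) ⊖_ ⊕-assoc ⊕-comm ⊕-identityˡ ⊕-inverseˡ
    ; ≈⇒≡ = id ; size = n ; enum = mk↔ₛ′ id id (λ _ → refl) (λ _ → refl) }

∷-↔ : ∀ {n} → (Bool × Vec Bool n) ↔ Vec Bool (suc n)
∷-↔ = mk↔ₛ′ (λ (b , v) → b ∷ v) (λ v → Vec.head v , Vec.tail v) (λ { (b ∷ v) → refl }) (λ _ → refl)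

Vec-enum : ∀ n → Fin (2 ℕ.^ n) ↔ Vec Bool n
Vec-enum zero = mk↔ₛ′ (λ _ → []) (λ _ → zero) (λ { [] → refl }) (λ { zero → refl })
Vec-enum (suc n) = ∷-↔ ↔-∘ ((Finₚ.2↔Bool ×-↔ Vec-enum n) ↔-∘ Finₚ.*↔×)

infixl 6 _⊻_

_⊻_ : ∀ {n} → Vec Bool n → Vec Bool n → Vec Bool n
_⊻_ = Vec.zipWith _xor_

𝟘 : ∀ {n} → Vec Bool n
𝟘 = Vec.replicate _ false

⊻-same : ∀ {n} (v : Vec Bool n) → v ⊻ v ≡ 𝟘
⊻-same [] = refl
⊻-same (b ∷ v) = cong₂ _∷_ (Boolₚ.xor-same b) (⊻-same v)

cube : ℕ → FiniteAbelianGroup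
cube n = record
  { abGroup = abelianGroup (Vec Bool n) _⊻_ 𝟘 id
      (Vecₚ.zipWith-assoc Boolₚ.xor-assoc) (Vecₚ.zipWith-comm Boolₚ.xor-comm)
      (Vecₚ.zipWith-identityˡ Boolₚ.xor-identityˡ) ⊻-same
  ; ≈⇒≡ = id ; size = 2 ℕ.^ n ; enum = Vec-enum n }

module Lattice (G₀ : FiniteAbelianGroup) where
  open Ambient G₀
  private module G₀ = AbelianGroup (strict G₀)

  ambient : AbelianGroup 0ℓ 0ℓ
  ambient = abelianGroup G _+ᴳ_ 0ᴳ -ᴳ_
    (λ { (a , b , x) (c , d , y) (e , f , z) →
       cong₂ _,_ (ℤₚ.+-assoc a c e) (cong₂ _,_ (ℤₚ.+-assoc b d f) (G₀.assoc x y z)) })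
    (λ { (a , b , x) (c , d , y) →
       cong₂ _,_ (ℤₚ.+-comm a c) (cong₂ _,_ (ℤₚ.+-comm b d) (G₀.comm x y)) })
    (λ { (a , b , x) →
       cong₂ _,_ (ℤₚ.+-identityˡ a) (cong₂ _,_ (ℤₚ.+-identityˡ b) (G₀.identityˡ x)) })
    (λ { (a , b , x) →
       cong₂ _,_ (ℤₚ.+-inverseˡ a) (cong₂ _,_ (ℤₚ.+-inverseˡ b) (G₀.inverseˡ x)) })

-- Merging two tiling equations

Z₅ : FiniteAbelianGroup
Z₅ = cyclic 5

private
  module Z₅ = FiniteAbelianGroup Z₅
  module Z₅ₛ = AbelianGroup (strict Z₅)

E₁ E₂ : List (Fin 5)
E₁ = 0F ∷ 1F ∷ []
E₂ = 2F ∷ 3F ∷ 4F ∷ []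

block : List (Fin 5) → Fin 5 → List (Fin 5)
block E φ = map (φ Z₅.∙_) E

Meet : List (Fin 5) → List (Fin 5) → Fin 5 → Fin 5 → Set
Meet E E′ φ ψ = ∃[ h ] (h ∈ block E φ × h ∈ block E′ ψ)

meet? : ∀ E E′ φ ψ → Dec (Meet E E′ φ ψ)
meet? E E′ φ ψ = Finₚ.any? λ h → (h ∈? block E φ) ×-dec (h ∈? block E′ ψ)

abstract
  E₁E₂-disjoint : ∀ e → e ∈ E₁ → e ∈ E₂ → ⊥
  E₁E₂-disjoint = from-yes (Finₚ.all? λ e → (e ∈? E₁) →-dec ((e ∈? E₂) →-dec no id))

  E₁⊎E₂ : ∀ e → e ∈ E₁ ⊎ e ∈ E₂
  E₁⊎E₂ = from-yes (Finₚ.all? λ e → (e ∈? E₁) ⊎-dec (e ∈? E₂))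

  -- `E₁` and `E₂` are complementary in Z₅ and no nonzero translation fixes either, so translates of
  -- the two are disjoint only for equal offsets.
  meet₁₂ : ∀ φ ψ → φ ≡ ψ ⊎ Meet E₁ E₂ φ ψ
  meet₁₂ = from-yes (Finₚ.all? λ φ → Finₚ.all? λ ψ → (φ Finₚ.≟ ψ) ⊎-dec meet? E₁ E₂ φ ψ)

  meet₂₂ : ∀ φ ψ → Meet E₂ E₂ φ ψ
  meet₂₂ = from-yes (Finₚ.all? λ φ → Finₚ.all? λ ψ → meet? E₂ E₂ φ ψ)

  ∉-block-E₂ : ∀ ψ → ψ ∉ block E₂ ψ
  ∉-block-E₂ = from-yes (Finₚ.all? λ ψ → ¬? (ψ ∈? block E₂ ψ))

  -- Z₅ is not a disjoint union of translates of E₁, as 5 is odd.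
  three-pairs : ∀ φ φ₁ φ₂ →
    φ Z₅.∙ 2F ∈ block E₁ φ₁ → φ Z₅.∙ 4F ∈ block E₁ φ₂ →
    (φ ≢ φ₁ × Meet E₁ E₁ φ φ₁) ⊎ (φ ≢ φ₂ × Meet E₁ E₁ φ φ₂) ⊎ (φ₁ ≢ φ₂ × Meet E₁ E₁ φ₁ φ₂)
  three-pairs = from-yes (Finₚ.all? λ φ → Finₚ.all? λ φ₁ → Finₚ.all? λ φ₂ →
    ((φ Z₅.∙ 2F) ∈? block E₁ φ₁) →-dec (((φ Z₅.∙ 4F) ∈? block E₁ φ₂) →-dec
    (clash φ φ₁ ⊎-dec (clash φ φ₂ ⊎-dec clash φ₁ φ₂))))
    where
    clash : ∀ φ ψ → Dec (φ ≢ ψ × Meet E₁ E₁ φ ψ)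
    clash φ ψ = ¬? (φ Finₚ.≟ ψ) ×-dec meet? E₁ E₁ φ ψ

-- The only solution of 2a + 3b = 5 in natural numbers is a = b = 1.
module _ {P₁ P₂ : Fin 5 → Set}
  (cover : ∀ h → (∃[ φ ] (P₁ φ × h ∈ block E₁ φ)) ⊎ (∃[ φ ] (P₂ φ × h ∈ block E₂ φ)))
  (unique₁ : ∀ {φ ψ} → P₁ φ → P₁ ψ → Meet E₁ E₁ φ ψ → φ ≡ ψ)
  (unique₂ : ∀ {φ ψ} → P₂ φ → P₂ ψ → Meet E₂ E₂ φ ψ → φ ≡ ψ)
  (disjoint : ∀ {φ ψ} → P₁ φ → P₂ ψ → Meet E₁ E₂ φ ψ → ⊥)
  where

  offset-agree : ∀ {φ ψ} → P₁ φ → P₂ ψ → φ ≡ ψ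
  offset-agree {φ} {ψ} p q with meet₁₂ φ ψ
  ... | inj₁ eq = eq
  ... | inj₂ m = ⊥-elim (disjoint p q m)

  private
    -- The block of kind 2 at ψ leaves ψ itself uncovered. Another block of kind 2 covering ψ would
    -- meet the first one, since 3 + 3 > 5, and so coincide with it. Hence a block of kind 1 covers
    -- ψ, and disjointness gives it the offset ψ.
    from-P₂ : ∀ {ψ} → P₂ ψ → ∃[ φ ] (P₁ φ × P₂ φ)
    from-P₂ {ψ} q with cover ψ
    ... | inj₁ (φ , p , _) = ψ , subst P₁ (offset-agree p q) p , q
    ... | inj₂ (φ , q′ , ψ∈φ) =
      ⊥-elim (∉-block-E₂ ψ (subst (λ χ → ψ ∈ block E₂ χ) (unique₂ q′ q (meet₂₂ φ ψ)) ψ∈φ))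

  both-occur : ∃[ φ ] (P₁ φ × P₂ φ)
  both-occur with cover 0F
  ... | inj₂ (_ , q , _) = from-P₂ q
  -- The block of kind 1 at φ covers φ and φ + 1 only. If blocks of kind 1 also covered φ + 2 and φ
  -- + 4, two different ones among the three would overlap.
  ... | inj₁ (φ , p , _) with cover (φ Z₅.∙ 2F) | cover (φ Z₅.∙ 4F)
  ... | inj₂ (_ , q , _) | _ = from-P₂ q
  ... | inj₁ _ | inj₂ (_ , q , _) = from-P₂ q
  ... | inj₁ (φ₁ , p₁ , m₁) | inj₁ (φ₂ , p₂ , m₂) with three-pairs φ φ₁ φ₂ m₁ m₂
  ... | inj₁ (≢ , m) = ⊥-elim (≢ (unique₁ p p₁ m))
  ... | inj₂ (inj₁ (≢ , m)) = ⊥-elim (≢ (unique₁ p p₂ m))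
  ... | inj₂ (inj₂ (≢ , m)) = ⊥-elim (≢ (unique₁ p₁ p₂ m))

module System (G₀ : FiniteAbelianGroup) where
  open Ambient G₀ public
  open Lattice G₀ public
  private module G₀ = FiniteAbelianGroup G₀

  -- One horizontal period is all that is extracted from periodicity; unlike a decomposition into
  -- cosets, it passes directly to projections and to maps read off from A.
  HorizontallyPeriodic : Subset → Set
  HorizontallyPeriodic A = ∃[ n ] (∀ g → A g → A (g +ᴳ (+ suc n , ℤ.0ℤ , G₀.ε)))

  AperiodicSystem : List (List G) → Set₁
  AperiodicSystem Fs =
    (∃[ A ] All (Tiles A) Fs) × (∀ A → All (Tiles A) Fs → HorizontallyPeriodic A → ⊥)

module Merge (G₀ : FiniteAbelianGroup) where
  private
    module S = System G₀
    module S′ = System (G₀ ⊗ Z₅)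
  open S using (G; _+ᴳ_)
  open S′ using () renaming (G to G′; _+ᴳ_ to _+′_)

  pair : G → Fin 5 → G′
  pair (a , b , x) h = a , b , x , h

  base : G′ → G
  base (a , b , x , _) = a , b , x

  level : G′ → Fin 5
  level (_ , _ , _ , h) = h

  pair-injective : ∀ {g g′ h h′} → pair g h ≡ pair g′ h′ → g ≡ g′ × h ≡ h′
  pair-injective eq = cong base eq , cong level eq

  infixr 7 _⊠_
  _⊠_ : List G → List (Fin 5) → List G′
  _⊠_ = cartesianProductWith pair

  ∈-⊠ : ∀ {F E f} → f ∈ F ⊠ E → ∃[ f₀ ] ∃[ e ] (f₀ ∈ F × e ∈ E × f ≡ pair f₀ e)
  ∈-⊠ {F} {E} f∈ with ∈-cartesianProductWith⁻ pair F E f∈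
  ... | f₀ , e , f₀∈ , e∈ , eq = f₀ , e , f₀∈ , e∈ , eq

  merged : List G → List G → List G′
  merged F₁ F₂ = F₁ ⊠ E₁ ++ F₂ ⊠ E₂

  ∈-merged : ∀ {F₁ F₂ f} → f ∈ merged F₁ F₂ →
    ∃[ f₀ ] ∃[ e ] (f ≡ pair f₀ e × ((f₀ ∈ F₁ × e ∈ E₁) ⊎ (f₀ ∈ F₂ × e ∈ E₂)))
  ∈-merged {F₁} {F₂} f∈ with ∈-++⁻ (F₁ ⊠ E₁) f∈
  ... | inj₁ f∈₁ = let (f₀ , e , f₀∈ , e∈ , eq) = ∈-⊠ {F₁} f∈₁ in f₀ , e , eq , inj₁ (f₀∈ , e∈)
  ... | inj₂ f∈₂ = let (f₀ , e , f₀∈ , e∈ , eq) = ∈-⊠ {F₂} f∈₂ in f₀ , e , eq , inj₂ (f₀∈ , e∈)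

  -- A full factor Z₅ hides the levels of the points of A, so an equation that is not being merged
  -- is carried over unchanged: a tiling by `thicken F` projects to a tiling by F.
  thicken : List G → List G′
  thicken F = F ⊠ allFin 5

  slice : S.Subset → S′.Subset
  slice A g = A (base g) × level g ≡ 0F

  project : S′.Subset → S.Subset
  project A g = ∃[ h ] A (pair g h)

  slice-tiles-thicken : ∀ {A F} → S.Tiles A F → S′.Tiles (slice A) (thicken F)
  slice-tiles-thicken {A} {F} (cover , unique) =
    (λ (a , b , x , h) → let (c , f , c∈A , f∈F , eq) = cover (a , b , x) in
       pair c 0F , pair f h , (c∈A , refl) , ∈-cartesianProductWith⁺ pair f∈F (∈-allFin h) ,
       cong₂ pair eq (Z₅ₛ.identityˡ h)) ,
    λ { c c′ f f′ (c∈A , refl) (c′∈A , refl) f∈ f′∈ eq → help c c′ c∈A c′∈A (∈-⊠ {F} f∈) (∈-⊠ {F} f′∈) eq }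
    where
    help : ∀ c c′ {f f′} → A (base c) → A (base c′) →
      (∃[ f₀ ] ∃[ e ] (f₀ ∈ F × e ∈ allFin 5 × f ≡ pair f₀ e)) →
      (∃[ f₀ ] ∃[ e ] (f₀ ∈ F × e ∈ allFin 5 × f′ ≡ pair f₀ e)) →
      pair (base c) 0F +′ f ≡ pair (base c′) 0F +′ f′ → pair (base c) 0F ≡ pair (base c′) 0F
    help c c′ c∈A c′∈A (f₀ , _ , f∈ , _ , refl) (f₀′ , _ , f∈′ , _ , refl) eq =
      cong (λ a → pair a 0F) (unique _ _ f₀ f₀′ c∈A c′∈A f∈ f∈′ (cong base eq))

  slice-tiles-merged : ∀ {A F₁ F₂} → S.Tiles A F₁ → S.Tiles A F₂ → S′.Tiles (slice A) (merged F₁ F₂)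
  slice-tiles-merged {A} {F₁} {F₂} (cover₁ , unique₁) (cover₂ , unique₂) = cover , unique
    where
    cover : ∀ g → ∃[ a ] ∃[ f ] (slice A a × f ∈ merged F₁ F₂ × a +′ f ≡ g)
    cover (a , b , x , h) with E₁⊎E₂ h
    ... | inj₁ h∈ = let (c , f , c∈A , f∈F , eq) = cover₁ (a , b , x) in
      pair c 0F , pair f h , (c∈A , refl) , ∈-++⁺ˡ (∈-cartesianProductWith⁺ pair f∈F h∈) ,
      cong₂ pair eq (Z₅ₛ.identityˡ h)
    ... | inj₂ h∈ = let (c , f , c∈A , f∈F , eq) = cover₂ (a , b , x) in
      pair c 0F , pair f h , (c∈A , refl) , ∈-++⁺ʳ (F₁ ⊠ E₁) (∈-cartesianProductWith⁺ pair f∈F h∈) ,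
      cong₂ pair eq (Z₅ₛ.identityˡ h)

    same-level : ∀ {e e′} → 0F Z₅.∙ e ≡ 0F Z₅.∙ e′ → e ≡ e′
    same-level {e} {e′} eq = trans (sym (Z₅ₛ.identityˡ e)) (trans eq (Z₅ₛ.identityˡ e′))

    unique : ∀ a a′ f f′ → slice A a → slice A a′ → f ∈ merged F₁ F₂ → f′ ∈ merged F₁ F₂ →
      a +′ f ≡ a′ +′ f′ → a ≡ a′
    unique (a , b , x , _) (a′ , b′ , x′ , _) f f′ (c∈A , refl) (c′∈A , refl) f∈ f′∈ eq
      with ∈-merged {F₁} f∈ | ∈-merged {F₁} f′∈
    ... | f₀ , e , refl , inj₁ (f₀∈ , e∈) | f₀′ , e′ , refl , inj₁ (f₀′∈ , e′∈) =
      cong (λ c → pair c 0F) (unique₁ _ _ f₀ f₀′ c∈A c′∈A f₀∈ f₀′∈ (cong base eq))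
    ... | f₀ , e , refl , inj₂ (f₀∈ , e∈) | f₀′ , e′ , refl , inj₂ (f₀′∈ , e′∈) =
      cong (λ c → pair c 0F) (unique₂ _ _ f₀ f₀′ c∈A c′∈A f₀∈ f₀′∈ (cong base eq))
    ... | f₀ , e , refl , inj₁ (f₀∈ , e∈) | f₀′ , e′ , refl , inj₂ (f₀′∈ , e′∈) =
      ⊥-elim (E₁E₂-disjoint e e∈ (subst (_∈ E₂) (sym (same-level (cong level eq))) e′∈))
    ... | f₀ , e , refl , inj₂ (f₀∈ , e∈) | f₀′ , e′ , refl , inj₁ (f₀′∈ , e′∈) =
      ⊥-elim (E₁E₂-disjoint e′ e′∈ (subst (_∈ E₂) (same-level (cong level eq)) e∈))

  thicken-tiles-project : ∀ {A F} → S′.Tiles A (thicken F) → S.Tiles (project A) F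
  thicken-tiles-project {A} {F} (cover , unique) = cover′ , unique′
    where
    cover′ : ∀ g → ∃[ a ] ∃[ f ] (project A a × f ∈ F × a +ᴳ f ≡ g)
    cover′ g with cover (pair g 0F)
    ... | a , f , a∈ , f∈ , eq with ∈-⊠ {F} f∈
    ... | f₀ , e , f₀∈ , _ , refl = base a , f₀ , (level a , a∈) , f₀∈ , cong base eq

    unique′ : ∀ a a′ f f′ → project A a → project A a′ → f ∈ F → f′ ∈ F → a +ᴳ f ≡ a′ +ᴳ f′ → a ≡ a′
    -- The tile elements at levels -h and -h′ bring both sums to level 0, where uniqueness for
    -- `thicken F` applies.
    unique′ a a′ f f′ (h , a∈) (h′ , a′∈) f∈ f′∈ eq = proj₁ (pair-injective (unique
      (pair a h) (pair a′ h′) (pair f (h Z₅.⁻¹)) (pair f′ (h′ Z₅.⁻¹)) a∈ a′∈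
      (∈-cartesianProductWith⁺ pair f∈ (∈-allFin _)) (∈-cartesianProductWith⁺ pair f′∈ (∈-allFin _))
      (cong₂ pair eq (trans (Z₅ₛ.inverseʳ h) (sym (Z₅ₛ.inverseʳ h′))))))

  module _ {A F₁ F₂} (tiles : S′.Tiles A (merged F₁ F₂)) (g : G) where
    private
      Piece : List G → Fin 5 → Set
      Piece F φ = ∃[ a ] ∃[ f ] (A (pair a φ) × f ∈ F × a +ᴳ f ≡ g)

      cover : ∀ h → (∃[ φ ] (Piece F₁ φ × h ∈ block E₁ φ)) ⊎ (∃[ φ ] (Piece F₂ φ × h ∈ block E₂ φ))
      cover h with proj₁ tiles (pair g h)
      ... | a , f , a∈ , f∈ , eq with ∈-merged {F₁} f∈
      ... | f₀ , e , refl , inj₁ (f₀∈ , e∈) = inj₁ (level a , (base a , f₀ , a∈ , f₀∈ , cong base eq) ,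
        subst (_∈ block E₁ (level a)) (cong level eq) (∈-map⁺ (level a Z₅.∙_) e∈))
      ... | f₀ , e , refl , inj₂ (f₀∈ , e∈) = inj₂ (level a , (base a , f₀ , a∈ , f₀∈ , cong base eq) ,
        subst (_∈ block E₂ (level a)) (cong level eq) (∈-map⁺ (level a Z₅.∙_) e∈))

      -- A level h shared by the two blocks gives two representations of `pair g h`. Uniqueness
      -- identifies their points of A, and cancelling φ identifies the levels inside the tile.
      collide : ∀ {E E′ F F′ φ ψ} ((a , _) : Piece F φ) ((a′ , _) : Piece F′ ψ) →
        (∀ {f e} → f ∈ F → e ∈ E → pair f e ∈ merged F₁ F₂) →
        (∀ {f e} → f ∈ F′ → e ∈ E′ → pair f e ∈ merged F₁ F₂) →
        Meet E E′ φ ψ → a ≡ a′ × φ ≡ ψ × ∃[ e ] (e ∈ E × e ∈ E′)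
      collide {φ = φ} (a , f , a∈ , f∈ , eq) (a′ , f′ , a′∈ , f′∈ , eq′) in₁ in₂ (h , h∈ , h∈′)
        with ∈-map⁻ _ h∈ | ∈-map⁻ _ h∈′
      ... | e , e∈ , refl | e′ , e′∈ , h≡
        with pair-injective (proj₂ tiles _ _ _ _ a∈ a′∈ (in₁ f∈ e∈) (in₂ f′∈ e′∈)
               (cong₂ pair (trans eq (sym eq′)) h≡))
      ... | refl , refl = refl , refl , e , e∈ ,
        subst (_∈ _) (sym (GroupProperties.∙-cancelˡ (AbelianGroup.group (strict Z₅)) φ _ _ h≡)) e′∈

      in₁ : ∀ {f e} → f ∈ F₁ → e ∈ E₁ → pair f e ∈ merged F₁ F₂
      in₁ f∈ e∈ = ∈-++⁺ˡ (∈-cartesianProductWith⁺ pair f∈ e∈)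
      in₂ : ∀ {f e} → f ∈ F₂ → e ∈ E₂ → pair f e ∈ merged F₁ F₂
      in₂ f∈ e∈ = ∈-++⁺ʳ (F₁ ⊠ E₁) (∈-cartesianProductWith⁺ pair f∈ e∈)

      disjoint : ∀ {φ ψ} → Piece F₁ φ → Piece F₂ ψ → Meet E₁ E₂ φ ψ → ⊥
      disjoint p q m with collide p q in₁ in₂ m
      ... | _ , _ , e , e∈₁ , e∈₂ = E₁E₂-disjoint e e∈₁ e∈₂

      occur : ∃[ φ ] (Piece F₁ φ × Piece F₂ φ)
      occur = both-occur cover (λ p q m → proj₁ (proj₂ (collide p q in₁ in₁ m)))
        (λ p q m → proj₁ (proj₂ (collide p q in₂ in₂ m))) disjoint

      agree : ∀ {φ ψ} → Piece F₁ φ → Piece F₂ ψ → φ ≡ ψ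
      agree = offset-agree cover (λ p q m → proj₁ (proj₂ (collide p q in₁ in₁ m)))
        (λ p q m → proj₁ (proj₂ (collide p q in₂ in₂ m))) disjoint

    covers₁ : ∃[ a ] ∃[ f ] (project A a × f ∈ F₁ × a +ᴳ f ≡ g)
    covers₁ = let (φ , (a , f , a∈ , f∈ , eq) , _) = occur in a , f , (φ , a∈) , f∈ , eq

    covers₂ : ∃[ a ] ∃[ f ] (project A a × f ∈ F₂ × a +ᴳ f ≡ g)
    covers₂ = let (φ , _ , (a , f , a∈ , f∈ , eq)) = occur in a , f , (φ , a∈) , f∈ , eq

    -- Two translates of `E₁` may be disjoint, so `collide` does not apply at once. But both offsets
    -- equal that of the block of kind 2 over g, so the two blocks are the same and meet.
    unique₁ : ∀ {a a′ f f′} → project A a → project A a′ → f ∈ F₁ → f′ ∈ F₁ →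
      a +ᴳ f ≡ g → a′ +ᴳ f′ ≡ g → a ≡ a′
    unique₁ {a} {a′} {f} {f′} (φ , a∈) (ψ , a′∈) f∈ f′∈ eq eq′ =
      proj₁ (collide {E₁} {E₁} p q in₁ in₁ (subst (Meet E₁ E₁ φ) φ≡ψ (_ , ∈-map⁺ (φ Z₅.∙_) 0∈ , ∈-map⁺ (φ Z₅.∙_) 0∈)))
      where
      p : Piece F₁ φ
      p = a , f , a∈ , f∈ , eq
      q : Piece F₁ ψ
      q = a′ , f′ , a′∈ , f′∈ , eq′
      φ≡ψ : φ ≡ ψ
      φ≡ψ = trans (agree p (proj₂ (proj₂ occur))) (sym (agree q (proj₂ (proj₂ occur))))
      0∈ : 0F ∈ E₁
      0∈ = from-yes (0F ∈? E₁)

    unique₂ : ∀ {a a′ f f′} → project A a → project A a′ → f ∈ F₂ → f′ ∈ F₂ →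
      a +ᴳ f ≡ g → a′ +ᴳ f′ ≡ g → a ≡ a′
    unique₂ {a} {a′} {f} {f′} (φ , a∈) (ψ , a′∈) f∈ f′∈ eq eq′ =
      proj₁ (collide {E₂} {E₂} (a , f , a∈ , f∈ , eq) (a′ , f′ , a′∈ , f′∈ , eq′) in₂ in₂ (meet₂₂ φ ψ))

  merge : ∀ F₁ F₂ Fs → S.AperiodicSystem (F₁ ∷ F₂ ∷ Fs) →
    S′.AperiodicSystem (merged F₁ F₂ ∷ map thicken Fs)
  merge F₁ F₂ Fs ((A , t₁ ∷ t₂ ∷ ts) , aperiodic) =
    (slice A , slice-tiles-merged {A} {F₁} {F₂} t₁ t₂ ∷ Allₚ.map⁺ (All.map (λ {F} → slice-tiles-thicken {A} {F}) ts)) ,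
    λ { A′ (t ∷ ts′) (n , shift) → aperiodic (project A′)
          ( ((λ g → covers₁ {A′} {F₁} {F₂} t g) , λ _ _ _ _ a a′ f f′ eq → unique₁ {A′} {F₁} {F₂} t _ a a′ f f′ eq refl)
          ∷ ((λ g → covers₂ {A′} {F₁} {F₂} t g) , λ _ _ _ _ a a′ f f′ eq → unique₂ {A′} {F₁} {F₂} t _ a a′ f f′ eq refl)
          ∷ All.map (λ {F} → thicken-tiles-project {A′} {F}) (Allₚ.map⁻ ts′))
          (n , λ g (h , g∈) → h Z₅.∙ 0F , shift (pair g h) g∈) }

single-tile : ∀ G₀ F Fs → System.AperiodicSystem G₀ (F ∷ Fs) →
  ∃[ G₁ ] ∃[ F₁ ] System.AperiodicSystem G₁ (F₁ ∷ [])
single-tile G₀ F Fs = go (length Fs) G₀ F Fs refl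
  where
  -- The recursion is on the number of remaining equations, because the group gains a factor Z₅ at
  -- each merger.
  go : ∀ n G₀ F Fs → length Fs ≡ n → System.AperiodicSystem G₀ (F ∷ Fs) →
    ∃[ G₁ ] ∃[ F₁ ] System.AperiodicSystem G₁ (F₁ ∷ [])
  go _ G₀ F [] _ system = G₀ , F , system
  go (suc n) G₀ F (F′ ∷ Fs) len system =
    go n (G₀ ⊗ Z₅) (Merge.merged G₀ F F′) (map (Merge.thicken G₀) Fs)
      (trans (length-map (Merge.thicken G₀) Fs) (ℕₚ.suc-injective len)) (Merge.merge G₀ F F′ Fs system)

-- Tilings by graphs

module Graphs (P V : FiniteAbelianGroup) where
  open System (P ⊗ V) public
  private
    module P = FiniteAbelianGroup P
    module V = FiniteAbelianGroup V
    module AP = Ambient P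
    module 𝒫 = AbelianGroup (Lattice.ambient P)
    module 𝒫ₚ = GroupProperties (AbelianGroup.group (Lattice.ambient P))
    module 𝒱 = AbelianGroup (strict V)

  Point : Set
  Point = AP.G

  infixl 6 _─_
  _─_ : V.Carrier → V.Carrier → V.Carrier
  u ─ v = u V.∙ (v V.⁻¹)

  infix 5 _▸_
  _▸_ : Point → V.Carrier → G
  (a , b , p) ▸ v = a , b , p , v

  point : G → Point
  point (a , b , p , _) = a , b , p

  value : G → V.Carrier
  value (_ , _ , _ , v) = v

  -- The part {offset} × {v : `Accepts v`} of a tile that lies over one base point.
  record Piece : Set₁ where
    field
      offset   : Point
      Accepts  : V.Carrier → Set
      accepts? : ∀ v → Dec (Accepts v)
  open Piece

  cells : Piece → List G
  cells π = map (offset π ▸_) (filter (accepts? π) (elements V))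

  tile : List Piece → List G
  tile = concatMap cells

  ∈-tile⁺ : ∀ {πs π v} → π ∈ πs → Accepts π v → (offset π ▸ v) ∈ tile πs
  ∈-tile⁺ {π = π} {v} π∈ ok = ∈-concatMap⁺ cells
    (lose π∈ (∈-map⁺ (offset π ▸_) (∈-filter⁺ (accepts? π) (∈-elements V v) ok)))

  ∈-tile⁻ : ∀ {πs f} → f ∈ tile πs →
    ∃[ π ] ∃[ v ] (π ∈ πs × Accepts π v × f ≡ (offset π ▸ v))
  ∈-tile⁻ {πs} f∈ with find (∈-concatMap⁻ cells {xs = πs} f∈)
  ... | π , π∈ , f∈π with ∈-map⁻ (offset π ▸_) f∈π
  ... | v , v∈ , eq = π , v , π∈ , proj₂ (∈-filter⁻ (accepts? π) {xs = elements V} v∈) , eq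

  ─-cancel : ∀ u v → u V.∙ (v ─ u) ≡ v
  ─-cancel u v = trans (𝒱.comm u (v ─ u)) (trans (𝒱.assoc v (u V.⁻¹) u)
    (trans (cong (v V.∙_) (𝒱.inverseˡ u)) (𝒱.identityʳ v)))

  ∙─ : ∀ u v → (u V.∙ v) ─ u ≡ v
  ∙─ u v = trans (cong (_─ u) (𝒱.comm u v)) (trans (𝒱.assoc v u (u V.⁻¹))
    (trans (cong (v V.∙_) (𝒱.inverseʳ u)) (𝒱.identityʳ v)))

  +─ : ∀ x o → (x AP.-ᴳ o) AP.+ᴳ o ≡ x
  +─ x o = trans (𝒫.assoc x (AP.-ᴳ o) o) (trans (cong (x AP.+ᴳ_) (𝒫.inverseˡ o)) (𝒫.identityʳ x))

  ─+ : ∀ x o → (x AP.+ᴳ o) AP.-ᴳ o ≡ x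
  ─+ x o = trans (𝒫.assoc x o (AP.-ᴳ o)) (trans (cong (x AP.+ᴳ_) (𝒫.inverseʳ o)) (𝒫.identityʳ x))

  graph : (Point → V.Carrier) → Subset
  graph φ g = value g ≡ φ (point g)

  -- A piece π can cover (y , h) only from the point of the graph over y - `offset π`, and does so
  -- when it accepts the remaining value. Equality of the offsets suffices for uniqueness, because
  -- the offset determines that point.
  graph-tiles : ∀ (φ : Point → V.Carrier) πs →
    (∀ y h → ∃[ π ] (π ∈ πs × Accepts π (h ─ φ (y AP.-ᴳ offset π)))) →
    (∀ y h {π π′} → π ∈ πs → π′ ∈ πs → Accepts π (h ─ φ (y AP.-ᴳ offset π)) →
       Accepts π′ (h ─ φ (y AP.-ᴳ offset π′)) → offset π ≡ offset π′) →
    Tiles (graph φ) (tile πs)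
  graph-tiles φ πs exists unique = cover , unique′
    where
    cover : ∀ g → ∃[ a ] ∃[ f ] (graph φ a × f ∈ tile πs × a +ᴳ f ≡ g)
    cover g with exists (point g) (value g)
    ... | π , π∈ , ok = let x = point g AP.-ᴳ offset π in
      (x ▸ φ x) , (offset π ▸ (value g ─ φ x)) , refl , ∈-tile⁺ π∈ ok ,
      cong₂ _▸_ (+─ (point g) (offset π)) (─-cancel (φ x) (value g))

    recover : ∀ a π v → graph φ a → Accepts π v →
      Accepts π (value (a +ᴳ (offset π ▸ v)) ─ φ (point (a +ᴳ (offset π ▸ v)) AP.-ᴳ offset π))
    recover a π v a∈ ok = subst (Accepts π) (sym (trans
      (cong₂ (λ u x → (u V.∙ v) ─ φ x) a∈ (─+ (point a) (offset π))) (∙─ (φ (point a)) v))) ok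

    unique′ : ∀ a a′ f f′ → graph φ a → graph φ a′ → f ∈ tile πs → f′ ∈ tile πs →
      a +ᴳ f ≡ a′ +ᴳ f′ → a ≡ a′
    unique′ a a′ f f′ a∈ a′∈ f∈ f′∈ eq with ∈-tile⁻ {πs} f∈ | ∈-tile⁻ {πs} f′∈
    ... | π , v , π∈ , ok , refl | π′ , v′ , π′∈ , ok′ , refl =
      cong₂ _▸_ x≡x′ (trans a∈ (trans (cong φ x≡x′) (sym a′∈)))
      where
      o≡o′ : offset π ≡ offset π′
      o≡o′ = unique (point (a +ᴳ (offset π ▸ v))) (value (a +ᴳ (offset π ▸ v))) π∈ π′∈
        (recover a π v a∈ ok)
        (subst (λ g → Accepts π′ (value g ─ φ (point g AP.-ᴳ offset π′))) (sym eq) (recover a′ π′ v′ a′∈ ok′))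
      x≡x′ : point a ≡ point a′
      x≡x′ = 𝒫ₚ.∙-cancelʳ (offset π) _ _ (trans (cong point eq) (cong (point a′ AP.+ᴳ_) (sym o≡o′)))

  separates : ∀ {A : Subset} (φ : Point → V.Carrier) πs → Tiles A (tile πs) → (∀ x → A (x ▸ φ x)) →
    ∀ {π π′ x x′ h} → π ∈ πs → π′ ∈ πs → x AP.+ᴳ offset π ≡ x′ AP.+ᴳ offset π′ →
    Accepts π (h ─ φ x) → Accepts π′ (h ─ φ x′) → x ≡ x′
  separates φ πs (_ , unique) A-graph {x = x} {x′} {h} π∈ π′∈ eq ok ok′ =
    cong point (unique _ _ _ _ (A-graph x) (A-graph x′) (∈-tile⁺ {πs = πs} π∈ ok) (∈-tile⁺ {πs = πs} π′∈ ok′)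
      (cong₂ _▸_ eq (trans (─-cancel (φ x) h) (sym (─-cancel (φ x′) h)))))

  fibre : List Piece
  fibre = record { offset = AP.0ᴳ ; Accepts = λ _ → ⊤ ; accepts? = λ _ → yes tt } ∷ []

  graph-tiles-fibre : ∀ φ → Tiles (graph φ) (tile fibre)
  graph-tiles-fibre φ = graph-tiles φ fibre (λ _ _ → _ , here refl , tt)
    λ { _ _ (here refl) (here refl) _ _ → refl }

  module _ {A : Subset} (tiles : Tiles A (tile fibre)) where

    section : ∀ x → ∃[ v ] A (x ▸ v)
    section x with proj₁ tiles (x ▸ V.ε)
    ... | a , f , a∈ , f∈ , eq with ∈-tile⁻ {fibre} f∈
    ... | _ , v , here refl , _ , refl =
      value a , subst (λ y → A (y ▸ value a)) (trans (sym (𝒫.identityʳ (point a))) (cong point eq)) a∈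

    section-unique : ∀ {x v v′} → A (x ▸ v) → A (x ▸ v′) → v ≡ v′
    section-unique {x} {v} {v′} a∈ a′∈ = cong value (proj₂ tiles _ _ _ _ a∈ a′∈
      (∈-tile⁺ {πs = fibre} {v = v V.⁻¹} (here refl) tt) (∈-tile⁺ {πs = fibre} {v = v′ V.⁻¹} (here refl) tt)
      (cong (x AP.+ᴳ AP.0ᴳ ▸_) (trans (𝒱.inverseʳ v) (sym (𝒱.inverseʳ v′)))))

  -- Tiling equation expressing that χ (φ x) = χ (φ (x + o)) + χ κ for a homomorphism χ, where
  -- t is the indicator of a fibre of χ.
  shift : (V.Carrier → Bool) → Point → V.Carrier → List Piece
  shift t o κ =
      record { offset = AP.0ᴳ ; Accepts = λ v → t v ≡ true ; accepts? = λ v → t v Boolₚ.≟ true }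
    ∷ record { offset = AP.-ᴳ o ; Accepts = λ v → t (v ─ κ) ≡ false ; accepts? = λ v → t (v ─ κ) Boolₚ.≟ false }
    ∷ []

  x-0 : ∀ x → x AP.-ᴳ AP.0ᴳ ≡ x
  x-0 x = trans (cong (x AP.+ᴳ_) 𝒫ₚ.ε⁻¹≈ε) (𝒫.identityʳ x)

  graph-tiles-shift : ∀ φ t o κ → (∀ x h → t (h ─ φ x) ≡ t (h ─ φ (x AP.+ᴳ o) ─ κ)) →
    Tiles (graph φ) (tile (shift t o κ))
  graph-tiles-shift φ t o κ law = graph-tiles φ (shift t o κ) exists unique
    where
    law′ : ∀ y h → t (h ─ φ (y AP.-ᴳ AP.0ᴳ)) ≡ t (h ─ φ (y AP.-ᴳ (AP.-ᴳ o)) ─ κ)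
    law′ y h = subst₂ (λ x z → t (h ─ φ x) ≡ t (h ─ φ (y AP.+ᴳ z) ─ κ))
      (sym (x-0 y)) (sym (𝒫ₚ.⁻¹-involutive o)) (law y h)
    exists : ∀ y h → ∃[ π ] (π ∈ shift t o κ × Accepts π (h ─ φ (y AP.-ᴳ offset π)))
    exists y h with t (h ─ φ (y AP.-ᴳ AP.0ᴳ)) in eq
    ... | true = _ , here refl , eq
    ... | false = _ , there (here refl) , trans (sym (law′ y h)) eq
    unique : ∀ y h {π π′} → π ∈ shift t o κ → π′ ∈ shift t o κ → Accepts π (h ─ φ (y AP.-ᴳ offset π)) →
      Accepts π′ (h ─ φ (y AP.-ᴳ offset π′)) → offset π ≡ offset π′
    unique y h (here refl) (here refl) _ _ = refl
    unique y h (there (here refl)) (there (here refl)) _ _ = refl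
    unique y h (here refl) (there (here refl)) p q with () ← trans (sym p) (trans (law′ y h) q)
    unique y h (there (here refl)) (here refl) q p with () ← trans (sym p) (trans (law′ y h) q)

  -- Consider the point (x , φ x). The first piece placed at x covers it, as t holds at the
  -- identity. If t failed at the value in question, the second piece placed at x + o would cover it
  -- too, and uniqueness would give x = x + o.
  shift-law : ∀ {A : Subset} (φ : Point → V.Carrier) t o κ → Tiles A (tile (shift t o κ)) → (∀ x → A (x ▸ φ x)) →
    o ≢ AP.0ᴳ → t V.ε ≡ true → ∀ x → t (φ x ─ φ (x AP.+ᴳ o) ─ κ) ≡ true
  shift-law φ t o κ tiles A-graph o≢0 tε x = Boolₚ.¬-not λ eq →
    o≢0 (𝒫ₚ.identityʳ-unique x o (sym (separates φ (shift t o κ) tiles A-graph {h = φ x}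
      (here refl) (there (here refl)) (trans (𝒫.identityʳ x) (sym (─+ x o)))
      (trans (cong t (𝒱.inverseʳ (φ x))) tε) eq)))

-- Cyclic linear systems over F₂

all-Bool? : ∀ {p} {P : Bool → Set p} → (∀ b → Dec (P b)) → Dec (∀ b → P b)
all-Bool? P? with P? true | P? false
... | yes pt | yes pf = yes λ { true → pt ; false → pf }
... | no ¬pt | _ = no λ p → ¬pt (p true)
... | _ | no ¬pf = no λ p → ¬pf (p false)

infixl 7 _⊼_
_⊼_ : ∀ {n} → Vec Bool n → Vec Bool n → Vec Bool n
_⊼_ = Vec.zipWith _∧_

𝟙 : ∀ {n} → Vec Bool n
𝟙 = Vec.replicate _ true

-- The system r₀ = s, rᵢ₊₁ = zᵢ + (1 + σᵢ) rᵢ, with final value e. When z = c + b r and s = e, each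
-- coefficient 1 + bᵢ + σᵢ of rᵢ is 1 just if bᵢ = σᵢ, and the cyclic system is uniquely solvable
-- unless all coefficients are 1.
Chain : ∀ {n} → Bool → (σ r z : Vec Bool n) → Bool → Set
Chain s [] [] [] e = s ≡ e
Chain s (σ ∷ σs) (r ∷ rs) (z ∷ zs) e = r ≡ s × Chain (z xor (not σ ∧ r)) σs rs zs e

chain? : ∀ {n} s (σ r z : Vec Bool n) e → Dec (Chain s σ r z e)
chain? s [] [] [] e = s Boolₚ.≟ e
chain? s (σ ∷ σs) (r ∷ rs) (z ∷ zs) e = (r Boolₚ.≟ s) ×-dec chain? _ σs rs zs e

Loop : ∀ {n} → (σ r z : Vec Bool n) → Set
Loop σ r z = ∃[ s ] Chain s σ r z s

loop? : ∀ {n} (σ r z : Vec Bool n) → Dec (Loop σ r z)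
loop? σ r z with chain? true σ r z true | chain? false σ r z false
... | yes c | _ = yes (true , c)
... | _ | yes c = yes (false , c)
... | no ¬c | no ¬c′ = no λ { (true , c) → ¬c c ; (false , c) → ¬c′ c }

-- One stage of the chain after substituting z = c + b r: over F₂ it is c + (1 + b + σ) s. From here
-- on, a start value s determines all later values.
next : (c b σ s : Bool) → Bool
next c b σ s = (c xor (b ∧ s)) xor (not σ ∧ s)

trace : ∀ {n} → Bool → (σ c b : Vec Bool n) → Vec Bool n
trace s [] [] [] = []
trace s (σ ∷ σs) (c ∷ cs) (b ∷ bs) = s ∷ trace (next c b σ s) σs cs bs

final : ∀ {n} → Bool → (σ c b : Vec Bool n) → Bool
final s [] [] [] = s
final s (σ ∷ σs) (c ∷ cs) (b ∷ bs) = final (next c b σ s) σs cs bs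

chain-trace : ∀ {n} s (σ c b : Vec Bool n) →
  Chain s σ (trace s σ c b) (c ⊻ (b ⊼ trace s σ c b)) (final s σ c b)
chain-trace s [] [] [] = refl
chain-trace s (σ ∷ σs) (c ∷ cs) (b ∷ bs) = refl , chain-trace _ σs cs bs

chain-unique : ∀ {n} s (σ c b r : Vec Bool n) e → Chain s σ r (c ⊻ (b ⊼ r)) e →
  r ≡ trace s σ c b × e ≡ final s σ c b
chain-unique s [] [] [] [] e refl = refl , refl
chain-unique s (σ ∷ σs) (c ∷ cs) (b ∷ bs) (r ∷ rs) e (refl , ch) =
  let (p , q) = chain-unique _ σs cs bs rs e ch in cong (s ∷_) p , q

next-≢ : ∀ c b σ → b ≢ σ → next c b σ true ≡ next c b σ false
next-≢ = from-yes (all-Bool? λ c → all-Bool? λ b → all-Bool? λ σ →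
  ¬? (b Boolₚ.≟ σ) →-dec (next c b σ true Boolₚ.≟ next c b σ false))

next-≡ : ∀ c σ → next c σ σ true ≡ not (next c σ σ false)
next-≡ = from-yes (all-Bool? λ c → all-Bool? λ σ → next c σ σ true Boolₚ.≟ not (next c σ σ false))

-- A stage at which b and σ differ has coefficient 0 and forgets its input. The stages before the
-- first such one have coefficient 1 and at most exchange the two inputs.
final-constant : ∀ {n} (σ c b : Vec Bool n) → b ≢ σ → final true σ c b ≡ final false σ c b
final-constant [] [] [] b≢σ = ⊥-elim (b≢σ refl)
final-constant (σ ∷ σs) (c ∷ cs) (b ∷ bs) b≢σ with b Boolₚ.≟ σ
... | no b≢ = cong (λ s → final s σs cs bs) (next-≢ c b σ b≢)
... | yes refl = trans (cong (λ s → final s σs cs bs) (next-≡ c σ)) (swap (next c b b false))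
  where
  rest : final true σs cs bs ≡ final false σs cs bs
  rest = final-constant σs cs bs (b≢σ ∘ cong (σ ∷_))
  swap : ∀ s → final (not s) σs cs bs ≡ final s σs cs bs
  swap true = sym rest
  swap false = rest

final-independent : ∀ {n} (σ c b : Vec Bool n) → b ≢ σ → ∀ s s′ → final s σ c b ≡ final s′ σ c b
final-independent σ c b b≢σ true true = refl
final-independent σ c b b≢σ true false = final-constant σ c b b≢σ
final-independent σ c b b≢σ false true = sym (final-constant σ c b b≢σ)
final-independent σ c b b≢σ false false = refl

loop-exists : ∀ {n} (σ c b : Vec Bool n) → b ≢ σ → ∃[ r ] Loop σ r (c ⊻ (b ⊼ r))
loop-exists σ c b b≢σ = trace s σ c b , s ,
  subst (Chain s σ _ _) (final-independent σ c b b≢σ s true) (chain-trace s σ c b)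
  where
  s : Bool
  s = final true σ c b

loop-unique : ∀ {n} (σ c b r r′ : Vec Bool n) → b ≢ σ →
  Loop σ r (c ⊻ (b ⊼ r)) → Loop σ r′ (c ⊻ (b ⊼ r′)) → r ≡ r′
loop-unique σ c b r r′ b≢σ (s , ch) (s′ , ch′)
  with chain-unique s σ c b r s ch | chain-unique s′ σ c b r′ s′ ch′
... | r≡ , s≡ | r′≡ , s′≡ = trans r≡ (trans (cong (λ u → trace u σ c b) s≡s′) (sym r′≡))
  where
  s≡s′ : s ≡ s′
  s≡s′ = trans s≡ (trans (final-independent σ c b b≢σ s s′) (sym s′≡))

loop-𝟘 : ∀ {n} (σ : Vec Bool n) → Loop σ 𝟘 𝟘
loop-𝟘 σ = false , go σ
  where
  go : ∀ {n} (σ : Vec Bool n) → Chain false σ 𝟘 𝟘 false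
  go [] = refl
  go (σ ∷ σs) = refl , subst (λ s → Chain s σs 𝟘 𝟘 false) (sym (Boolₚ.∧-zeroʳ (not σ))) (go σs)

-- For b = σ and c = 𝟘 both r = 𝟘 (by `loop-𝟘`) and r = 𝟙 solve the cyclic system. This double
-- solution is what makes `forbid σ` exclude the slope σ.
loop-𝟙 : ∀ {n} (σ : Vec Bool n) → Loop σ 𝟙 σ
loop-𝟙 σ = true , go σ
  where
  go : ∀ {n} (σ : Vec Bool n) → Chain true σ 𝟙 σ true
  go [] = refl
  go (true ∷ σs) = refl , go σs
  go (false ∷ σs) = refl , go σs

-- Bit fields on the plane

Z₄ : FiniteAbelianGroup
Z₄ = cyclic 4

private
  module Z₄ = FiniteAbelianGroup Z₄

double : Bool → Fin 4
double b = if b then 2F else 0F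

even : Fin 4 → Bool
even 0F = true
even 1F = false
even 2F = true
even 3F = false

lift : Bool → Fin 4
lift b = if b then 1F else 0F

is-zero : Fin 4 → Bool
is-zero w = ⌊ w Finₚ.≟ 0F ⌋

infixl 6 _⊝_
_⊝_ : Fin 4 → Fin 4 → Fin 4
v ⊝ w = v Z₄.∙ (w Z₄.⁻¹)

abstract
  -- With w = w(p) ∈ Z₄, w(1) − w(0) odd, and fᵢ = f(x, i), fᵢ′ = f(x + e₁, i) ∈ F₂: if w + 2f
  -- satisfies (w + 2f)(x + e₁, p + 1) = (w + 2f)(x, p) − 1, then f(1) − f(0) changes from x to x + e₁.
  flip-forced : ∀ w₀ w₁ → even ((w₀ ⊝ w₁) ⊝ 1F) ≡ true → ∀ f₀ f₁ f₀′ f₁′ →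
    is-zero (((w₀ ⊝ w₁) ⊝ 1F) Z₄.∙ double ((f₀ xor f₁′) xor false)) ≡ true →
    is-zero (((w₁ ⊝ w₀) ⊝ 1F) Z₄.∙ double ((f₁ xor f₀′) xor false)) ≡ true →
    f₀′ xor f₁′ ≡ not (f₀ xor f₁)
  flip-forced = from-yes (Finₚ.all? λ w₀ → Finₚ.all? λ w₁ →
    (even ((w₀ ⊝ w₁) ⊝ 1F) Boolₚ.≟ true) →-dec
    (all-Bool? λ f₀ → all-Bool? λ f₁ → all-Bool? λ f₀′ → all-Bool? λ f₁′ →
      (is-zero (((w₀ ⊝ w₁) ⊝ 1F) Z₄.∙ double ((f₀ xor f₁′) xor false)) Boolₚ.≟ true) →-dec
      ((is-zero (((w₁ ⊝ w₀) ⊝ 1F) Z₄.∙ double ((f₁ xor f₀′) xor false)) Boolₚ.≟ true) →-dec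
      (f₀′ xor f₁′ Boolₚ.≟ not (f₀ xor f₁)))))

  -- Here w = `lift p`, and f is β(x) for p = 0 and β(x + 1) for p = 1. So w + 2f is 2β(x) or 1 +
  -- 2β(x + 1). At x + 1 and the opposite p it becomes 1 + 2β(x + 2) = 2β(x) - 1 or 2β(x + 1), in
  -- both cases one less modulo 4, because β(x + 2) = β(x) + 1.
  flip-realised : ∀ w f p β β₁ →
    is-zero ((w ⊝ lift p) Z₄.∙ double (f xor (β xor ((β xor β₁) ∧ p)))) ≡
    is-zero (((w ⊝ lift (p xor true)) ⊝ 1F) Z₄.∙
      double ((f xor (β₁ xor ((β₁ xor not β) ∧ (p xor true)))) xor false))
  flip-realised = from-yes (Finₚ.all? λ w → all-Bool? λ f → all-Bool? λ p → all-Bool? λ β → all-Bool? λ β₁ →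
    is-zero ((w ⊝ lift p) Z₄.∙ double (f xor (β xor ((β xor β₁) ∧ p)))) Boolₚ.≟
    is-zero (((w ⊝ lift (p xor true)) ⊝ 1F) Z₄.∙
      double ((f xor (β₁ xor ((β₁ xor not β) ∧ (p xor true)))) xor false)))

  parity-realised : ∀ w p → even (w ⊝ lift p) ≡ even ((w ⊝ lift (p xor true)) ⊝ 1F)
  parity-realised = from-yes (Finₚ.all? λ w → all-Bool? λ p →
    even (w ⊝ lift p) Boolₚ.≟ even ((w ⊝ lift (p xor true)) ⊝ 1F))

  zero-difference : ∀ w w′ → is-zero ((w ⊝ w′) ⊝ 0F) ≡ true → w ≡ w′
  zero-difference = from-yes (Finₚ.all? λ w → Finₚ.all? λ w′ →
    (is-zero ((w ⊝ w′) ⊝ 0F) Boolₚ.≟ true) →-dec (w Finₚ.≟ w′))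

  ⊝-0 : ∀ w → w ⊝ 0F ≡ w
  ⊝-0 = from-yes (Finₚ.all? λ w → w ⊝ 0F Finₚ.≟ w)

not-difference : ∀ b c → not ((b xor c) xor false) ≡ true → b ≡ c
not-difference = from-yes (all-Bool? λ b → all-Bool? λ c →
  (not ((b xor c) xor false) Boolₚ.≟ true) →-dec (b Boolₚ.≟ c))

⊻-𝟘 : ∀ {n} (v : Vec Bool n) → v ⊻ 𝟘 ≡ v
⊻-𝟘 = Vecₚ.zipWith-identityʳ Boolₚ.xor-identityʳ

⊻-⊼-distrib : ∀ {n} (b p r : Vec Bool n) → b ⊼ (p ⊻ r) ≡ (b ⊼ p) ⊻ (b ⊼ r)
⊻-⊼-distrib [] [] [] = refl
⊻-⊼-distrib (b ∷ bs) (p ∷ ps) (r ∷ rs) = cong₂ _∷_ (Boolₚ.∧-distribˡ-xor b p r) (⊻-⊼-distrib bs ps rs)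

⊻-assoc : ∀ {n} (u v w : Vec Bool n) → (u ⊻ v) ⊻ w ≡ u ⊻ (v ⊻ w)
⊻-assoc = Vecₚ.zipWith-assoc Boolₚ.xor-assoc

module Fields (n : ℕ) (dir : Fin n → ℤ × ℤ) (dir≢0 : ∀ i → dir i ≢ (0ℤ , 0ℤ))
  (R : Vec Bool (suc n) → Set) (R? : ∀ b → Dec (R b)) where

  Field : Set
  Field = ℤ → ℤ → Vec Bool (suc n)

  record Admissible (b : Field) : Set where
    field
      constant  : ∀ x y i → lookup (b (x ℤ.+ proj₁ (dir i)) (y ℤ.+ proj₂ (dir i))) (suc i) ≡ lookup (b x y) (suc i)
      alternate : ∀ x y → lookup (b (x ℤ.+ 1ℤ) y) zero ≡ not (lookup (b x y) zero)
      allowed   : ∀ x y → R (b x y)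

  open Graphs (cube (suc n)) (cube (suc n) ⊗ Z₄) public
  private module Point = Ambient (cube (suc n))

  Value : Set
  Value = Vec Bool (suc n) × Fin 4

  slope : (Point → Value) → Field
  slope φ x y = proj₁ (φ (x , y , 𝟘)) ⊻ proj₁ (φ (x , y , 𝟙))

  coordinate : Fin (suc n) → Value → Bool
  coordinate i (u , _) = not (lookup u i)

  keep : Fin n → List Piece
  keep i = shift (coordinate (suc i)) (proj₁ (dir i) , proj₂ (dir i) , 𝟘) (𝟘 , 0F)

  -- They make w constant along (1 , 0), make w change parity under p ↦ p + 𝟙, and relate the
  -- homomorphism (u , w) ↦ w + 2u₀ to Z₄ at a point and at its neighbour with the opposite p.
  keep-clock odd-clock flip : List Piece
  keep-clock = shift (is-zero ∘ proj₂) (1ℤ , 0ℤ , 𝟘) (𝟘 , 0F)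
  odd-clock = shift (even ∘ proj₂) (0ℤ , 0ℤ , 𝟙) (𝟘 , 1F)
  flip = shift (λ (u , w) → is-zero (w Z₄.∙ double (lookup u zero))) (1ℤ , 0ℤ , 𝟙) (𝟘 , 1F)

  -- If φ is affine in p with slope b, then the value left for the piece r has the coordinatewise
  -- form c + b r. The pieces that accept are thus the solutions r of the cyclic system of `Chain`,
  -- exactly one when b ≢ σ.
  forbid-piece : Vec Bool (suc n) → Vec Bool (suc n) → Piece
  forbid-piece σ r = record
    { offset = 0ℤ , 0ℤ , r ; Accepts = λ (z , _) → Loop σ r z ; accepts? = λ (z , _) → loop? σ r z }

  forbid : Vec Bool (suc n) → List Piece
  forbid σ = map (forbid-piece σ) (elements (cube (suc n)))

  excluded : List (Vec Bool (suc n))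
  excluded = filter (¬? ∘ R?) (elements (cube (suc n)))

  equations : List (List Piece)
  equations = keep-clock ∷ odd-clock ∷ flip ∷ (map keep (allFin n) ++ map forbid excluded)


  lookup-difference : ∀ (u v : Vec Bool (suc n)) i → lookup ((u ⊻ v) ⊻ 𝟘) i ≡ (lookup u i xor lookup v i) xor false
  lookup-difference u v i = trans (Vecₚ.lookup-zipWith _xor_ i (u ⊻ v) 𝟘)
    (cong₂ _xor_ (Vecₚ.lookup-zipWith _xor_ i u v) (Vecₚ.lookup-replicate i false))

  module _ {A : Subset} (φ : Point → Value) (tiles : All (Tiles A ∘ tile) equations) (A-graph : ∀ x → A (x ▸ φ x)) where
    private
      f : ℤ → ℤ → Vec Bool (suc n) → Fin (suc n) → Bool
      f x y p i = lookup (proj₁ (φ (x , y , p))) i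

      w : ℤ → ℤ → Vec Bool (suc n) → Fin 4
      w x y p = proj₂ (φ (x , y , p))

      kept : ∀ x y p i → f x y p (suc i) ≡ f (x ℤ.+ proj₁ (dir i)) (y ℤ.+ proj₂ (dir i)) p (suc i)
      kept x y p i = trans (not-difference _ _ (trans
          (cong not (sym (lookup-difference (proj₁ (φ (x , y , p)))
            (proj₁ (φ (x ℤ.+ proj₁ (dir i) , y ℤ.+ proj₂ (dir i) , p ⊻ 𝟘))) (suc i))))
          (shift-law φ (coordinate (suc i)) (proj₁ (dir i) , proj₂ (dir i) , 𝟘) (𝟘 , 0F)
            (All.lookup tiles (there (there (there (∈-++⁺ˡ (∈-map⁺ keep (∈-allFin i))))))) A-graph
            (λ eq → dir≢0 i (cong (λ (a , b , _) → a , b) eq)) (cong not (Vecₚ.lookup-replicate i false)) (x , y , p))))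
        (cong (λ q → f (x ℤ.+ proj₁ (dir i)) (y ℤ.+ proj₂ (dir i)) q (suc i)) (⊻-𝟘 p))

      w-kept : ∀ x y p → w x y p ≡ w (x ℤ.+ 1ℤ) y p
      w-kept x y p = trans (zero-difference _ _ (shift-law φ (is-zero ∘ proj₂) (1ℤ , 0ℤ , 𝟘) (𝟘 , 0F)
          (All.lookup tiles (here refl)) A-graph (λ ()) refl (x , y , p)))
        (cong₂ (w (x ℤ.+ 1ℤ)) (ℤₚ.+-identityʳ y) (⊻-𝟘 p))

      w-odd : ∀ x y → even ((w x y 𝟘 ⊝ w x y 𝟙) ⊝ 1F) ≡ true
      w-odd x y = trans (cong (λ (X : Point) → even ((w x y 𝟘 ⊝ proj₂ (φ X)) ⊝ 1F))
          (cong₂ _,_ (sym (ℤₚ.+-identityʳ x)) (cong₂ _,_ (sym (ℤₚ.+-identityʳ y))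
            (sym (Vecₚ.zipWith-identityˡ Boolₚ.xor-identityˡ 𝟙)))))
        (shift-law φ (even ∘ proj₂) (0ℤ , 0ℤ , 𝟙) (𝟘 , 1F)
          (All.lookup tiles (there (here refl))) A-graph (λ ()) refl (x , y , 𝟘))

      flipped : ∀ x y p q → p ⊻ 𝟙 ≡ q →
        is-zero (((w x y p ⊝ w x y q) ⊝ 1F) Z₄.∙ double ((f x y p zero xor f (x ℤ.+ 1ℤ) y q zero) xor false)) ≡ true
      flipped x y p q refl = trans
        (cong₂ (λ c d → is-zero (((w x y p ⊝ c) ⊝ 1F) Z₄.∙ double d)) (w-kept x y (p ⊻ 𝟙))
          (sym (lookup-difference (proj₁ (φ (x , y , p))) (proj₁ (φ (x ℤ.+ 1ℤ , y , p ⊻ 𝟙))) zero)))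
        (subst (λ z → is-zero (((w x y p ⊝ w (x ℤ.+ 1ℤ) z (p ⊻ 𝟙)) ⊝ 1F) Z₄.∙
            double (lookup ((proj₁ (φ (x , y , p)) ⊻ proj₁ (φ (x ℤ.+ 1ℤ , z , p ⊻ 𝟙))) ⊻ 𝟘) zero)) ≡ true)
          (ℤₚ.+-identityʳ y)
          (shift-law φ _ (1ℤ , 0ℤ , 𝟙) (𝟘 , 1F) (All.lookup tiles (there (there (here refl)))) A-graph (λ ()) refl (x , y , p)))

      slope-lookup : ∀ x y i → lookup (slope φ x y) i ≡ f x y 𝟘 i xor f x y 𝟙 i
      slope-lookup x y i = Vecₚ.lookup-zipWith _xor_ i (proj₁ (φ (x , y , 𝟘))) (proj₁ (φ (x , y , 𝟙)))

      -- If the slope σ were excluded, consider the value h = φ(x , y , 𝟘) over (x , y , 𝟘). The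
      -- remainders from p = 𝟘 and p = 𝟙 are 𝟘 and σ, so by `loop-𝟘` and `loop-𝟙` the pieces r = 𝟘
      -- and r = 𝟙 would both cover it.
      not-excluded : ∀ x y → R (slope φ x y)
      not-excluded x y = decidable-stable (R? σ) λ ¬Rσ → absurd (cong (λ (_ , _ , p) → lookup p zero)
        (separates φ (forbid σ)
          (All.lookup tiles (there (there (there (∈-++⁺ʳ (map keep (allFin n))
            (∈-map⁺ forbid (∈-filter⁺ (¬? ∘ R?) (∈-elements (cube (suc n)) σ) ¬Rσ))))))) A-graph
          {x = x , y , 𝟘} {x , y , 𝟙} {φ (x , y , 𝟘)}
          (∈-map⁺ (forbid-piece σ) (∈-elements (cube (suc n)) 𝟘)) (∈-map⁺ (forbid-piece σ) (∈-elements (cube (suc n)) 𝟙))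
          (cong (λ p → x ℤ.+ 0ℤ , y ℤ.+ 0ℤ , p) (trans (⊻-same 𝟘) (sym (⊻-same 𝟙))))
          (subst (Loop σ 𝟘) (sym (⊻-same (proj₁ (φ (x , y , 𝟘))))) (loop-𝟘 σ)) (loop-𝟙 σ)))
        where
        σ : Vec Bool (suc n)
        σ = slope φ x y
        absurd : false ≡ true → ⊥
        absurd ()

    slope-admissible : Admissible (slope φ)
    slope-admissible = record
      { constant = λ x y i → trans (slope-lookup _ _ (suc i))
          (trans (sym (cong₂ _xor_ (kept x y 𝟘 i) (kept x y 𝟙 i))) (sym (slope-lookup x y (suc i))))
      ; alternate = λ x y → trans (slope-lookup _ y zero) (trans
          (flip-forced (w x y 𝟘) (w x y 𝟙) (w-odd x y)
            (f x y 𝟘 zero) (f x y 𝟙 zero) (f (x ℤ.+ 1ℤ) y 𝟘 zero) (f (x ℤ.+ 1ℤ) y 𝟙 zero)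
            (flipped x y 𝟘 𝟙 (Vecₚ.zipWith-identityˡ Boolₚ.xor-identityˡ 𝟙)) (flipped x y 𝟙 𝟘 (⊻-same 𝟙)))
          (cong not (sym (slope-lookup x y zero))))
      ; allowed = not-excluded }

  module _ {b : Field} (b-admissible : Admissible b) (β : ℤ → Bool)
    (β-alternate : ∀ x → β (x ℤ.+ 1ℤ ℤ.+ 1ℤ) ≡ not (β x))
    (b-β : ∀ x y → lookup (b x y) zero ≡ β x xor β (x ℤ.+ 1ℤ)) where
    private
      module b = Admissible b-admissible

    -- Affine in p with slope b, as `forbid` demands. The constant term concerns only coordinate 0,
    -- which by `b-β` is β x where p₀ = 0 and β (x + 1) where p₀ = 1, as `flip` demands.
    field-map : Point → Value
    field-map (x , y , p) = (β x ∷ 𝟘) ⊻ (b x y ⊼ p) , lift (lookup p zero)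

    private
      φ : Point → Value
      φ = field-map

      φ-zero : ∀ x y p → lookup (proj₁ (φ (x , y , p))) zero ≡ β x xor ((β x xor β (x ℤ.+ 1ℤ)) ∧ lookup p zero)
      φ-zero x y p = trans (Vecₚ.lookup-zipWith _xor_ zero (β x ∷ 𝟘) (b x y ⊼ p))
        (cong (β x xor_) (trans (Vecₚ.lookup-zipWith _∧_ zero (b x y) p) (cong (_∧ lookup p zero) (b-β x y))))

      φ-suc : ∀ x y p i → lookup (proj₁ (φ (x , y , p))) (suc i) ≡ lookup (b x y) (suc i) ∧ lookup p (suc i)
      φ-suc x y p i = trans (Vecₚ.lookup-zipWith _xor_ (suc i) (β x ∷ 𝟘) (b x y ⊼ p))
        (cong₂ _xor_ (Vecₚ.lookup-replicate i false) (Vecₚ.lookup-zipWith _∧_ (suc i) (b x y) p))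

      keep-tiles : ∀ i → Tiles (graph φ) (tile (keep i))
      keep-tiles i = graph-tiles-shift φ _ (proj₁ (dir i) , proj₂ (dir i) , 𝟘) (𝟘 , 0F) λ (x , y , p) (h , _) → cong not (begin
        lookup (h ⊻ proj₁ (φ (x , y , p))) (suc i)
          ≡⟨ Vecₚ.lookup-zipWith _xor_ (suc i) h _ ⟩
        lookup h (suc i) xor lookup (proj₁ (φ (x , y , p))) (suc i)
          ≡⟨ cong (lookup h (suc i) xor_) (trans (φ-suc x y p i) (trans
               (cong₂ _∧_ (sym (b.constant x y i)) (cong (λ q → lookup q (suc i)) (sym (⊻-𝟘 p)))) (sym (φ-suc _ _ (p ⊻ 𝟘) i)))) ⟩
        lookup h (suc i) xor lookup (proj₁ (φ (x ℤ.+ proj₁ (dir i) , y ℤ.+ proj₂ (dir i) , p ⊻ 𝟘))) (suc i)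
          ≡⟨ Boolₚ.xor-identityʳ _ ⟨
        (lookup h (suc i) xor lookup (proj₁ (φ (x ℤ.+ proj₁ (dir i) , y ℤ.+ proj₂ (dir i) , p ⊻ 𝟘))) (suc i)) xor false
          ≡⟨ lookup-difference h _ (suc i) ⟨
        lookup ((h ⊻ proj₁ (φ (x ℤ.+ proj₁ (dir i) , y ℤ.+ proj₂ (dir i) , p ⊻ 𝟘))) ⊻ 𝟘) (suc i) ∎)
        where open ≡-Reasoning

      keep-clock-tiles : Tiles (graph φ) (tile keep-clock)
      keep-clock-tiles = graph-tiles-shift φ (is-zero ∘ proj₂) (1ℤ , 0ℤ , 𝟘) (𝟘 , 0F) λ (x , y , p) (h , v) →
        cong is-zero (trans (cong (λ q → v ⊝ lift (lookup q zero)) (sym (⊻-𝟘 p))) (sym (⊝-0 _)))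

      odd-clock-tiles : Tiles (graph φ) (tile odd-clock)
      odd-clock-tiles = graph-tiles-shift φ (even ∘ proj₂) (0ℤ , 0ℤ , 𝟙) (𝟘 , 1F)
        λ { (x , y , p ∷ _) (h , v) → parity-realised v p }

      flip-tiles : Tiles (graph φ) (tile flip)
      flip-tiles = graph-tiles-shift φ _ (1ℤ , 0ℤ , 𝟙) (𝟘 , 1F)
        λ { (x , y , p ∷ ps) (h , v) → trans
              (cong (λ c → is-zero ((v ⊝ lift p) Z₄.∙ double c))
                (trans (Vecₚ.lookup-zipWith _xor_ zero h _) (cong (lookup h zero xor_) (φ-zero x y (p ∷ ps)))))
              (trans (flip-realised v (lookup h zero) p (β x) (β (x ℤ.+ 1ℤ)))
              (cong (λ c → is-zero (((v ⊝ lift (p xor true)) ⊝ 1F) Z₄.∙ double c))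
                (trans (cong (λ c → (lookup h zero xor c) xor false)
                  (trans (cong (λ c → β (x ℤ.+ 1ℤ) xor ((β (x ℤ.+ 1ℤ) xor c) ∧ (p xor true))) (sym (β-alternate x)))
                    (sym (φ-zero (x ℤ.+ 1ℤ) (y ℤ.+ 0ℤ) ((p ∷ ps) ⊻ 𝟙)))))
                  (sym (lookup-difference h _ zero))))) }

      forbid-tiles : ∀ σ → ¬ R σ → Tiles (graph φ) (tile (forbid σ))
      forbid-tiles σ ¬Rσ = graph-tiles φ (forbid σ) exists unique
        where
        b≢σ : ∀ x y → b x y ≢ σ
        b≢σ x y refl = ¬Rσ (b.allowed x y)

        c : Point → Vec Bool (suc n) → Vec Bool (suc n)
        c (x , y , p) h = (h ⊻ (β x ∷ 𝟘)) ⊻ (b x y ⊼ p)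

        moved : ∀ x y p r h →
          h ⊻ proj₁ (φ (x ℤ.+ 0ℤ , y ℤ.+ 0ℤ , p ⊻ r)) ≡ c (x , y , p) h ⊻ (b x y ⊼ r)
        moved x y p r h = begin
          h ⊻ proj₁ (φ (x ℤ.+ 0ℤ , y ℤ.+ 0ℤ , p ⊻ r))
            ≡⟨ cong₂ (λ x y → h ⊻ proj₁ (φ (x , y , p ⊻ r))) (ℤₚ.+-identityʳ x) (ℤₚ.+-identityʳ y) ⟩
          h ⊻ ((β x ∷ 𝟘) ⊻ (b x y ⊼ (p ⊻ r)))
            ≡⟨ ⊻-assoc h (β x ∷ 𝟘) (b x y ⊼ (p ⊻ r)) ⟨
          (h ⊻ (β x ∷ 𝟘)) ⊻ (b x y ⊼ (p ⊻ r))
            ≡⟨ cong ((h ⊻ (β x ∷ 𝟘)) ⊻_) (⊻-⊼-distrib (b x y) p r) ⟩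
          (h ⊻ (β x ∷ 𝟘)) ⊻ ((b x y ⊼ p) ⊻ (b x y ⊼ r))
            ≡⟨ ⊻-assoc (h ⊻ (β x ∷ 𝟘)) (b x y ⊼ p) (b x y ⊼ r) ⟨
          c (x , y , p) h ⊻ (b x y ⊼ r) ∎
          where open ≡-Reasoning

        exists : ∀ X h → ∃[ π ] (π ∈ forbid σ × Piece.Accepts π (h ─ φ (X Point.-ᴳ Piece.offset π)))
        exists (x , y , p) (h , v) with loop-exists σ (c (x , y , p) h) (b x y) (b≢σ x y)
        ... | r , loop = forbid-piece σ r , ∈-map⁺ (forbid-piece σ) (∈-elements (cube (suc n)) r) ,
          subst (Loop σ r) (sym (moved x y p r h)) loop

        unique : ∀ X h {π π′} → π ∈ forbid σ → π′ ∈ forbid σ →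
          Piece.Accepts π (h ─ φ (X Point.-ᴳ Piece.offset π)) →
          Piece.Accepts π′ (h ─ φ (X Point.-ᴳ Piece.offset π′)) → Piece.offset π ≡ Piece.offset π′
        unique (x , y , p) (h , v) π∈ π′∈ ok ok′
          with ∈-map⁻ (forbid-piece σ) π∈ | ∈-map⁻ (forbid-piece σ) π′∈
        ... | r , _ , refl | r′ , _ , refl = cong (λ r → 0ℤ , 0ℤ , r)
          (loop-unique σ (c (x , y , p) h) (b x y) r r′ (b≢σ x y)
            (subst (Loop σ r) (moved x y p r h) ok) (subst (Loop σ r′) (moved x y p r′ h) ok′))

    field-tiles : All (Tiles (graph φ) ∘ tile) equations
    field-tiles = keep-clock-tiles ∷ odd-clock-tiles ∷ flip-tiles ∷
      Allₚ.++⁺ (Allₚ.map⁺ (All.tabulate λ {i} _ → keep-tiles i))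
        (Allₚ.map⁺ (All.tabulate λ {σ} σ∈ → forbid-tiles σ
          (proj₂ (∈-filter⁻ (¬? ∘ R?) {xs = elements (cube (suc n))} σ∈))))

  module _ {b : Field} (b-admissible : Admissible b) (β : ℤ → Bool)
    (β-alternate : ∀ x → β (x ℤ.+ 1ℤ ℤ.+ 1ℤ) ≡ not (β x))
    (b-β : ∀ x y → lookup (b x y) zero ≡ β x xor β (x ℤ.+ 1ℤ))
    (aperiodic : ∀ c → Admissible c → ∀ k → (∀ x y → c (x ℤ.+ + suc k) y ≡ c x y) → ⊥) where

    aperiodic-system : AperiodicSystem (tile fibre ∷ map tile equations)
    aperiodic-system =
      (graph (field-map b-admissible β β-alternate b-β) ,
        graph-tiles-fibre _ ∷ Allₚ.map⁺ (field-tiles b-admissible β β-alternate b-β)) ,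
      λ { A (t ∷ ts) (k , periodic) →
            let φ : Point → Value
                φ = proj₁ ∘ section t
                φ∈ : ∀ x → A (x ▸ φ x)
                φ∈ = proj₂ ∘ section t
                shifted : ∀ x y p → φ (x ℤ.+ + suc k , y , p) ≡ φ (x , y , p)
                -- Translating the point of A over (x , y , p) by the period gives a point of A over
                -- the shifted base point, and there is only one.
                shifted x y p = section-unique t (φ∈ _) (subst A
                  (cong₂ (λ y (q : Vec Bool (suc n) × Value) → x ℤ.+ + suc k , y , q) (ℤₚ.+-identityʳ y)
                    (cong₂ _,_ (⊻-𝟘 p) (AbelianGroup.identityʳ (strict (cube (suc n) ⊗ Z₄)) (φ (x , y , p)))))
                  (periodic _ (φ∈ (x , y , p))))
            in aperiodic (slope φ) (slope-admissible φ (Allₚ.map⁻ ts) φ∈) k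
                 (λ x y → cong₂ (λ u v → proj₁ u ⊻ proj₁ v) (shifted x y 𝟘) (shifted x y 𝟙)) }

    aperiodic-tile : ∃[ G₁ ] ∃[ F₁ ] System.AperiodicSystem G₁ (F₁ ∷ [])
    aperiodic-tile = single-tile (cube (suc n) ⊗ cube (suc n) ⊗ Z₄) (tile fibre) (map tile equations) aperiodic-system

-- Last nonzero digits in base 16

Z₁₆ : FiniteAbelianGroup
Z₁₆ = cyclic 16

Q : Set
Q = Fin 16

infixl 6 _⊹_ _⊟_

opaque
  _⊹_ : Q → Q → Q
  _⊹_ = FiniteAbelianGroup._∙_ Z₁₆

  neg : Q → Q
  neg = FiniteAbelianGroup._⁻¹ Z₁₆

  ⊹-assoc : ∀ a b c → (a ⊹ b) ⊹ c ≡ a ⊹ (b ⊹ c)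
  ⊹-assoc = FiniteAbelianGroup.assoc Z₁₆

  ⊹-comm : ∀ a b → a ⊹ b ≡ b ⊹ a
  ⊹-comm = FiniteAbelianGroup.comm Z₁₆

  ⊹-identityˡ : ∀ a → 0F ⊹ a ≡ a
  ⊹-identityˡ = FiniteAbelianGroup.identityˡ Z₁₆

  ⊹-inverseˡ : ∀ a → neg a ⊹ a ≡ 0F
  ⊹-inverseˡ = FiniteAbelianGroup.inverseˡ Z₁₆

_⊟_ : Q → Q → Q
a ⊟ b = a ⊹ neg b

Q-group : AbelianGroup 0ℓ 0ℓ
Q-group = abelianGroup Q _⊹_ 0F neg ⊹-assoc ⊹-comm ⊹-identityˡ ⊹-inverseˡ

module Qₛ = AbelianGroup Q-group
module Qₚ = GroupProperties (AbelianGroup.group Q-group)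

odd : Q → Bool
odd q = ⌊ toℕ q ℕ.% 2 ℕ.≟ 1 ⌋

_times_ : ℕ → Q → Q
zero times a = 0F
suc k times a = a ⊹ (k times a)

opaque
  unfolding _⊹_ neg

  odd-generates : ∀ a → odd a ≡ true → ∀ h → ∃[ k ] (toℕ {16} k times a) ≡ h
  odd-generates = from-yes (Finₚ.all? λ a → (odd a Boolₚ.≟ true) →-dec
    (Finₚ.all? λ h → Finₚ.any? λ k → (toℕ {16} k times a) Finₚ.≟ h))

  odd-order : ∀ a → odd a ≡ true → ∀ (k : Fin 16) → (toℕ k times a) ≡ 0F → k ≡ 0F
  odd-order = from-yes (Finₚ.all? λ a → (odd a Boolₚ.≟ true) →-dec
    (Finₚ.all? λ (k : Fin 16) → ((toℕ k times a) Finₚ.≟ 0F) →-dec (k Finₚ.≟ 0F)))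

  exponent : ∀ (a : Q) → let b = a ⊹ a ; c = b ⊹ b ; d = c ⊹ c in d ⊹ d ≡ 0F
  exponent = from-yes (Finₚ.all? λ a → let b = a ⊹ a ; c = b ⊹ b ; d = c ⊹ c in (d ⊹ d) Finₚ.≟ 0F)

  odd-difference : ∀ p q → odd q ≡ not (odd p) → odd (q ⊟ p) ≡ true
  odd-difference = from-yes (Finₚ.all? λ p → Finₚ.all? λ q →
    (odd q Boolₚ.≟ not (odd p)) →-dec (odd (q ⊟ p) Boolₚ.≟ true))

  1-inverse : 1F ⊹ neg (1F ⊹ 0F) ≡ 0F
  1-inverse = refl

  1-odd : odd (1F ⊹ 0F) ≡ true
  1-odd = refl

  neg-1 : neg (1F ⊹ 0F) ≡ neg 1F
  neg-1 = refl

-- Homomorphisms from ℤ to Z₁₆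

infixl 7 16×_
16×_ : ℤ → ℤ
16× t = + 16 ℤ.* t

16×-double : ∀ t → + 16 ℤ.* t ≡ ((t ℤ.+ t) ℤ.+ (t ℤ.+ t) ℤ.+ ((t ℤ.+ t) ℤ.+ (t ℤ.+ t))) ℤ.+
  ((t ℤ.+ t) ℤ.+ (t ℤ.+ t) ℤ.+ ((t ℤ.+ t) ℤ.+ (t ℤ.+ t)))
16×-double = solve-∀

16×-+ : ∀ s t → + 16 ℤ.* s ℤ.+ + 16 ℤ.* t ≡ + 16 ℤ.* (s ℤ.+ t)
16×-+ = solve-∀

IsHom : (ℤ → Q) → Set
IsHom ρ = ∀ s t → ρ (s ℤ.+ t) ≡ ρ s ⊹ ρ t

module Hom {ρ : ℤ → Q} (hom : IsHom ρ) where

  ρ-0 : ρ 0ℤ ≡ 0F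
  ρ-0 = Qₚ.identityʳ-unique (ρ 0ℤ) (ρ 0ℤ) (sym (hom 0ℤ 0ℤ))

  ρ-neg : ∀ t → ρ (ℤ.- t) ≡ neg (ρ t)
  ρ-neg t = Qₚ.inverseˡ-unique (ρ (ℤ.- t)) (ρ t)
    (trans (sym (hom (ℤ.- t) t)) (trans (cong ρ (ℤₚ.+-inverseˡ t)) ρ-0))

  ρ-16× : ∀ t → ρ (16× t) ≡ 0F
  ρ-16× t = trans (cong ρ (16×-double t)) (trans (twice _ (twice _ (twice _ (hom t t)))) (exponent (ρ t)))
    where
    twice : ∀ s {a} → ρ s ≡ a → ρ (s ℤ.+ s) ≡ a ⊹ a
    twice s refl = hom s s

  ρ-+16× : ∀ s t → ρ (s ℤ.+ 16× t) ≡ ρ s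
  ρ-+16× s t = trans (hom s (16× t)) (trans (cong (ρ s ⊹_) (ρ-16× t)) (Qₛ.identityʳ (ρ s)))

  ρ-16×+ : ∀ s t → ρ (16× t ℤ.+ s) ≡ ρ s
  ρ-16×+ s t = trans (cong ρ (ℤₚ.+-comm (16× t) s)) (ρ-+16× s t)

  ρ-times : ∀ k → ρ (+ k) ≡ k times ρ 1ℤ
  ρ-times zero = ρ-0
  ρ-times (suc k) = trans (hom 1ℤ (+ k)) (cong (ρ 1ℤ ⊹_) (ρ-times k))

  module _ (ρ-odd : odd (ρ 1ℤ) ≡ true) where

    preimage : ∀ h → ∃[ t ] ρ t ≡ h
    preimage h = let (k , eq) = odd-generates (ρ 1ℤ) ρ-odd h in + toℕ k , trans (ρ-times (toℕ k)) eq

    -- Write t = r + 16 q with r < 16. Since ρ kills 16 q, the multiple r ρ(1) vanishes, and an odd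
    -- element of Z₁₆ has order 16.
    kernel : ∀ t → ρ t ≡ 0F → ∃[ t′ ] t ≡ 16× t′
    kernel t ρt≡0 = q , (begin
      t                ≡⟨ decomposition ⟩
      + r ℤ.+ 16× q    ≡⟨ cong (λ r → + r ℤ.+ 16× q) r≡0 ⟩
      + 0 ℤ.+ 16× q    ≡⟨ ℤₚ.+-identityˡ (16× q) ⟩
      16× q            ∎)
      where
      open ≡-Reasoning
      q : ℤ
      q = t /ℕ 16
      r : ℕ
      r = t %ℕ 16
      r<16 : r ℕ.< 16
      r<16 = n%ℕd<d t 16
      decomposition : t ≡ + r ℤ.+ 16× q
      decomposition = trans (a≡a%ℕn+[a/ℕn]*n t 16) (cong (λ u → + r ℤ.+ u) (ℤₚ.*-comm q (+ 16)))
      r≡0 : r ≡ 0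
      r≡0 = trans (sym (Finₚ.toℕ-fromℕ< r<16)) (cong toℕ (odd-order (ρ 1ℤ) ρ-odd (Fin.fromℕ< r<16) (begin
        toℕ (Fin.fromℕ< r<16) times ρ 1ℤ  ≡⟨ cong (_times ρ 1ℤ) (Finₚ.toℕ-fromℕ< r<16) ⟩
        r times ρ 1ℤ                      ≡⟨ ρ-times r ⟨
        ρ (+ r)                           ≡⟨ ρ-+16× (+ r) q ⟨
        ρ (+ r ℤ.+ 16× q)                 ≡⟨ cong ρ decomposition ⟨
        ρ t                               ≡⟨ ρt≡0 ⟩
        0F                                ∎)))

residue : ℤ → Q
residue (+ n) = n times 1F
residue (ℤ.-[1+ n ]) = neg (suc n times 1F)

residue-suc : ∀ t → residue (1ℤ ℤ.+ t) ≡ 1F ⊹ residue t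
residue-suc (+ n) = refl
residue-suc (ℤ.-[1+ zero ]) = sym 1-inverse
residue-suc (ℤ.-[1+ suc n ]) = sym (begin
  1F ⊹ (neg (1F ⊹ s))        ≡⟨ cong (1F ⊹_) (Qₚ.⁻¹-anti-homo-∙ 1F s) ⟩
  1F ⊹ ((neg s) ⊹ (neg 1F))    ≡⟨ cong (1F ⊹_) (Qₛ.comm (neg s) (neg 1F)) ⟩
  1F ⊹ ((neg 1F) ⊹ (neg s))    ≡⟨ Qₛ.assoc 1F (neg 1F) (neg s) ⟨
  (1F ⊹ (neg 1F)) ⊹ (neg s)    ≡⟨ trans (cong (_⊹ neg s) (Qₛ.inverseʳ 1F)) (Qₛ.identityˡ (neg s)) ⟩
  neg s                    ∎)
  where
  open ≡-Reasoning
  s : Q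
  s = suc n times 1F

residue-pred : ∀ t → residue (ℤ.- 1ℤ ℤ.+ t) ≡ (neg 1F) ⊹ residue t
residue-pred t = begin
  residue t′                          ≡⟨ Qₛ.identityˡ (residue t′) ⟨
  0F ⊹ residue t′                     ≡⟨ cong (_⊹ residue t′) (Qₛ.inverseˡ 1F) ⟨
  ((neg 1F) ⊹ 1F) ⊹ residue t′        ≡⟨ Qₛ.assoc (neg 1F) 1F (residue t′) ⟩
  (neg 1F) ⊹ (1F ⊹ residue t′)          ≡⟨ cong ((neg 1F) ⊹_) (residue-suc t′) ⟨
  (neg 1F) ⊹ residue (1ℤ ℤ.+ t′)        ≡⟨ cong (λ u → (neg 1F) ⊹ residue u) (cancel t) ⟩
  (neg 1F) ⊹ residue t                  ∎
  where
  open ≡-Reasoning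
  t′ : ℤ
  t′ = ℤ.- 1ℤ ℤ.+ t
  cancel : ∀ t → 1ℤ ℤ.+ (ℤ.- 1ℤ ℤ.+ t) ≡ t
  cancel = solve-∀

residue-hom : IsHom residue
residue-hom (+ zero) t = trans (cong residue (ℤₚ.+-identityˡ t)) (sym (Qₛ.identityˡ (residue t)))
residue-hom (+ suc n) t = begin
  residue (+ suc n ℤ.+ t)              ≡⟨ cong residue (ℤₚ.+-assoc 1ℤ (+ n) t) ⟩
  residue (1ℤ ℤ.+ (+ n ℤ.+ t))         ≡⟨ residue-suc (+ n ℤ.+ t) ⟩
  1F ⊹ residue (+ n ℤ.+ t)             ≡⟨ cong (1F ⊹_) (residue-hom (+ n) t) ⟩
  1F ⊹ (residue (+ n) ⊹ residue t)     ≡⟨ Qₛ.assoc 1F (residue (+ n)) (residue t) ⟨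
  residue (+ suc n) ⊹ residue t        ∎
  where open ≡-Reasoning
residue-hom (ℤ.-[1+ zero ]) t = trans (residue-pred t) (cong (_⊹ residue t) (sym neg-1))
residue-hom (ℤ.-[1+ suc n ]) t = begin
  residue (ℤ.-[1+ suc n ] ℤ.+ t)                  ≡⟨ cong residue (ℤₚ.+-assoc (ℤ.- 1ℤ) ℤ.-[1+ n ] t) ⟩
  residue (ℤ.- 1ℤ ℤ.+ (ℤ.-[1+ n ] ℤ.+ t))         ≡⟨ residue-pred (ℤ.-[1+ n ] ℤ.+ t) ⟩
  (neg 1F) ⊹ residue (ℤ.-[1+ n ] ℤ.+ t)             ≡⟨ cong ((neg 1F) ⊹_) (residue-hom ℤ.-[1+ n ] t) ⟩
  (neg 1F) ⊹ (residue ℤ.-[1+ n ] ⊹ residue t)       ≡⟨ Qₛ.assoc (neg 1F) (residue ℤ.-[1+ n ]) (residue t) ⟨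
  ((neg 1F) ⊹ residue ℤ.-[1+ n ]) ⊹ residue t       ≡⟨ cong (_⊹ residue t) (residue-pred ℤ.-[1+ n ]) ⟨
  residue ℤ.-[1+ suc n ] ⊹ residue t              ∎
  where open ≡-Reasoning

module Residue = Hom {residue} residue-hom

-- Digit t d: d is the last nonzero digit of t in base 16.
data Digit (t : ℤ) (d : Q) : Set where
  unit  : residue t ≢ 0F → d ≡ residue t → Digit t d
  scale : ∀ {t′} → t ≡ 16× t′ → Digit t′ d → Digit t d

digit-unit : ∀ {t d} → residue t ≢ 0F → Digit t d → d ≡ residue t
digit-unit t≢0 (unit _ eq) = eq
digit-unit t≢0 (scale {t′} refl _) = ⊥-elim (t≢0 (Residue.ρ-16× t′))

digit-scale : ∀ {t d} → Digit (16× t) d → Digit t d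
digit-scale {t} (unit t≢0 _) = ⊥-elim (t≢0 (Residue.ρ-16× t))
digit-scale {t} {d} (scale {t′} eq δ) = subst (λ t → Digit t d) (sym (ℤₚ.*-cancelˡ-≡ (+ 16) t t′ eq)) δ

unit-or-multiple : ∀ t → residue t ≢ 0F ⊎ ∃[ t′ ] t ≡ 16× t′
unit-or-multiple t with residue t Finₚ.≟ 0F
... | yes eq = inj₂ (Residue.kernel 1-odd t eq)
... | no ≢0 = inj₁ ≢0

digit-neg : ∀ {t d} → Digit t d → Digit (ℤ.- t) (neg d)
digit-neg {t} (unit t≢0 refl) = unit
  (λ eq → t≢0 (Qₚ.⁻¹-injective (trans (trans (sym (Residue.ρ-neg t)) eq) (sym Qₚ.ε⁻¹≈ε)))) (sym (Residue.ρ-neg t))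
digit-neg (scale {t′} refl δ) = scale (ℤₚ.neg-distribʳ-* (+ 16) t′) (digit-neg δ)

digit : ∀ t → t ≢ 0ℤ → ∃[ d ] Digit t d
digit t = go t (<-wellFounded ℤ.∣ t ∣)
  where
  go : ∀ t → Acc ℕ._<_ ℤ.∣ t ∣ → t ≢ 0ℤ → ∃[ d ] Digit t d
  go t (acc rec) t≢0 with unit-or-multiple t
  ... | inj₁ ≢0 = residue t , unit ≢0 refl
  ... | inj₂ (t′ , refl) = let (d , δ) = go t′ (rec smaller) t′≢0 in d , scale refl δ
    where
    t′≢0 : t′ ≢ 0ℤ
    t′≢0 refl = t≢0 refl
    smaller : ℤ.∣ t′ ∣ ℕ.< ℤ.∣ 16× t′ ∣
    smaller = subst (ℤ.∣ t′ ∣ ℕ.<_) (trans (ℕₚ.*-comm ℤ.∣ t′ ∣ 16) (sym (ℤₚ.abs-* (+ 16) t′)))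
      (ℕₚ.m<m*n ℤ.∣ t′ ∣ 16 {{ℕ.≢-nonZero (t′≢0 ∘ ℤₚ.∣i∣≡0⇒i≡0)}} (ℕ.s≤s (ℕ.s≤s ℕ.z≤n)))

-- Possible digits p of M + 16 β if M has digit m, and β and M + β both have digit b.
Rel : (p m b : Q) → Set
Rel p m b = p ≡ m ⊹ b ⊎ p ≡ b ⊎ m ⊹ b ≡ 0F

-- Common factors 16 of M and β can be removed. If 16 does not divide M, then b = s leaves two
-- cases: 16 divides β and p = s, or m + b = 0. If 16 divides M but not β, then p is the digit of M
-- / 16 + β, which is b when 16 divides M / 16, and otherwise m + b unless this is 0.
partner-rule : ∀ {M β m b s p} → Digit M m → Digit β b → Digit (M ℤ.+ β) s → Digit (M ℤ.+ 16× β) p →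
  b ≡ s → Rel p m b
partner-rule {M} {β} (unit M≢0 refl) δβ δs δp b≡s with unit-or-multiple β
... | inj₂ (β′ , refl) = inj₂ (inj₁ (begin
  _                              ≡⟨ digit-unit (λ eq → M≢0 (trans (sym (Residue.ρ-+16× M β)) eq)) δp ⟩
  residue (M ℤ.+ 16× β)          ≡⟨ Residue.ρ-+16× M β ⟩
  residue M                      ≡⟨ Residue.ρ-+16× M β′ ⟨
  residue (M ℤ.+ 16× β′)         ≡⟨ digit-unit (λ eq → M≢0 (trans (sym (Residue.ρ-+16× M β′)) eq)) δs ⟨
  _                              ≡⟨ b≡s ⟨
  _                              ∎))
  where open ≡-Reasoning
... | inj₁ β≢0 with residue (M ℤ.+ β) Finₚ.≟ 0F
...   | yes z = inj₂ (inj₂ (trans (cong (residue M ⊹_) (digit-unit β≢0 δβ)) (trans (sym (residue-hom M β)) z)))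
...   | no nz = ⊥-elim (M≢0 (Qₚ.identityˡ-unique (residue M) (residue β) (begin
  residue M ⊹ residue β  ≡⟨ residue-hom M β ⟨
  residue (M ℤ.+ β)      ≡⟨ digit-unit nz δs ⟨
  _                      ≡⟨ b≡s ⟨
  _                      ≡⟨ digit-unit β≢0 δβ ⟩
  residue β              ∎)))
  where open ≡-Reasoning
partner-rule {M} {β} {m} {b} {s} {p} (scale {M′} refl δm) δβ δs δp b≡s with unit-or-multiple β
... | inj₂ (β′ , refl) = partner-rule δm (digit-scale δβ)
  (digit-scale (subst (λ t → Digit t s) (16×-+ M′ β′) δs))
  (digit-scale (subst (λ t → Digit t p) (16×-+ M′ (16× β′)) δp)) b≡s
... | inj₁ β≢0 with unit-or-multiple M′
...   | inj₂ (M″ , refl) = inj₂ (inj₁ (trans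
  (digit-unit (λ eq → β≢0 (trans (sym (Residue.ρ-16×+ β M″)) eq)) δp′)
  (trans (Residue.ρ-16×+ β M″) (sym (digit-unit β≢0 δβ)))))
  where
  δp′ : Digit (M′ ℤ.+ β) p
  δp′ = digit-scale (subst (λ t → Digit t p) (16×-+ M′ β) δp)
...   | inj₁ M′≢0 with residue (M′ ℤ.+ β) Finₚ.≟ 0F
...     | yes z = inj₂ (inj₂ (trans (cong₂ _⊹_ (digit-unit M′≢0 δm) (digit-unit β≢0 δβ))
  (trans (sym (residue-hom M′ β)) z)))
...     | no nz = inj₁ (trans (digit-unit nz (digit-scale (subst (λ t → Digit t p) (16×-+ M′ β) δp)))
  (trans (residue-hom M′ β) (sym (cong₂ _⊹_ (digit-unit M′≢0 δm) (digit-unit β≢0 δβ)))))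

-- After removal of common factors 16, either one summand is a multiple of 16 and the other supplies
-- the digit, or the residues add and can fail to give the digit only by cancelling.
addition-rule : ∀ {u v a b c} → Digit u a → Digit v b → Digit (u ℤ.+ v) c →
  c ≡ a ⊹ b ⊎ a ⊹ b ≡ 0F ⊎ c ≡ a ⊎ c ≡ b
addition-rule {u} {v} (unit u≢0 refl) δv δc with unit-or-multiple v
... | inj₂ (v′ , refl) = inj₂ (inj₂ (inj₁ (trans
  (digit-unit (λ eq → u≢0 (trans (sym (Residue.ρ-+16× u v′)) eq)) δc) (Residue.ρ-+16× u v′))))
... | inj₁ v≢0 with residue (u ℤ.+ v) Finₚ.≟ 0F
...   | yes z = inj₂ (inj₁ (trans (cong (residue u ⊹_) (digit-unit v≢0 δv)) (trans (sym (residue-hom u v)) z)))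
...   | no nz = inj₁ (trans (digit-unit nz δc) (trans (residue-hom u v) (cong (residue u ⊹_) (sym (digit-unit v≢0 δv)))))
addition-rule {u} {v} {a} {b} {c} (scale {u′} refl δu) δv δc with unit-or-multiple v
... | inj₂ (v′ , refl) = addition-rule δu (digit-scale δv) (digit-scale (subst (λ t → Digit t c) (16×-+ u′ v′) δc))
... | inj₁ v≢0 = inj₂ (inj₂ (inj₂ (trans
  (digit-unit (λ eq → v≢0 (trans (sym (Residue.ρ-16×+ v u′)) eq)) δc)
  (trans (Residue.ρ-16×+ v u′) (sym (digit-unit v≢0 δv))))))

-- Descent

-- Digits of three forms u, v, u + v and of a partner form of each of them.
record Rules (a b c a₁ b₁ c₁ : Q) : Set where
  constructor rules
  field
    A-partner : b ≡ c → Rel a₁ a b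
    B-partner : a ≡ c → Rel b₁ b a
    C-partner : a ⊹ b ≡ 0F → Rel c₁ c a
    addition  : c ≡ a ⊹ b ⊎ a ⊹ b ≡ 0F ⊎ c ≡ a ⊎ c ≡ b
open Rules

rules-cong : ∀ {a a′ b b′ c c′ p p′ q q′ r r′} → a ≡ a′ → b ≡ b′ → c ≡ c′ → p ≡ p′ → q ≡ q′ → r ≡ r′ →
  Rules a b c p q r → Rules a′ b′ c′ p′ q′ r′
rules-cong refl refl refl refl refl refl r = r

rel? : ∀ p m b → Dec (Rel p m b)
rel? p m b = (p Finₚ.≟ m ⊹ b) ⊎-dec ((p Finₚ.≟ b) ⊎-dec (m ⊹ b Finₚ.≟ 0F))

rules? : ∀ a b c a₁ b₁ c₁ → Dec (Rules a b c a₁ b₁ c₁)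
rules? a b c a₁ b₁ c₁ = map′ (λ (p , q , r , s) → rules p q r s)
  (λ r → A-partner r , B-partner r , C-partner r , addition r)
  (((b Finₚ.≟ c) →-dec rel? a₁ a b) ×-dec (((a Finₚ.≟ c) →-dec rel? b₁ b a) ×-dec
  (((a ⊹ b Finₚ.≟ 0F) →-dec rel? c₁ c a) ×-dec
  ((c Finₚ.≟ a ⊹ b) ⊎-dec ((a ⊹ b Finₚ.≟ 0F) ⊎-dec ((c Finₚ.≟ a) ⊎-dec (c Finₚ.≟ b)))))))

opaque
  unfolding _⊹_ neg

  -- For testing the addition rule at digits i, i and 2i + δ: with this i, all its alternatives are
  -- impossible unless δ = 0.
  generic : ∀ δ → ∃[ i ] (i ≢ 0F × i ⊹ i ≢ 0F × (i ⊹ i) ⊹ δ ≢ 0F ×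
    ((i ⊹ i) ⊹ δ ≡ i ⊹ i ⊎ (i ⊹ i) ≡ 0F ⊎ (i ⊹ i) ⊹ δ ≡ i ⊎ (i ⊹ i) ⊹ δ ≡ i → δ ≡ 0F))
  generic = from-yes (Finₚ.all? λ δ → Finₚ.any? λ i → ¬? (i Finₚ.≟ 0F) ×-dec (¬? (i ⊹ i Finₚ.≟ 0F) ×-dec
    (¬? ((i ⊹ i) ⊹ δ Finₚ.≟ 0F) ×-dec
    ((((i ⊹ i) ⊹ δ Finₚ.≟ i ⊹ i) ⊎-dec ((i ⊹ i Finₚ.≟ 0F) ⊎-dec
      (((i ⊹ i) ⊹ δ Finₚ.≟ i) ⊎-dec ((i ⊹ i) ⊹ δ Finₚ.≟ i)))) →-dec (δ Finₚ.≟ 0F)))))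

  cancel : ∀ i a → (i ⊹ a) ⊟ a ≡ i
  cancel = from-yes (Finₚ.all? λ i → Finₚ.all? λ a → (i ⊹ a) ⊟ a Finₚ.≟ i)

  cancel′ : ∀ a i → (a ⊟ i) ⊹ i ≡ a
  cancel′ = from-yes (Finₚ.all? λ a → Finₚ.all? λ i → (a ⊟ i) ⊹ i Finₚ.≟ a)

  ⊟-≡0 : ∀ a b → a ⊟ b ≡ 0F → a ≡ b
  ⊟-≡0 = from-yes (Finₚ.all? λ a → Finₚ.all? λ b → (a ⊟ b Finₚ.≟ 0F) →-dec (a Finₚ.≟ b))

  ⊟-⊟ : ∀ u t → u ⊟ (u ⊟ t) ≡ t
  ⊟-⊟ = from-yes (Finₚ.all? λ u → Finₚ.all? λ t → u ⊟ (u ⊟ t) Finₚ.≟ t)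

  both-nonzero : ∀ k → ∃[ i ] (i ≢ 0F × i ⊹ k ≢ 0F)
  both-nonzero = from-yes (Finₚ.all? λ k → Finₚ.any? λ i → ¬? (i Finₚ.≟ 0F) ×-dec ¬? (i ⊹ k Finₚ.≟ 0F))

regroup : ∀ i a b c → ((i ⊹ a) ⊹ (i ⊹ b)) ⊟ c ≡ (i ⊹ i) ⊹ ((a ⊹ b) ⊟ c)
regroup i a b c = trans (Qₛ.assoc (i ⊹ a) (i ⊹ b) (neg c)) (trans (Qₛ.assoc i a _)
  (trans (cong (i ⊹_) (trans (sym (Qₛ.assoc a (i ⊹ b) (neg c))) (trans (cong (_⊟ c) (trans (sym (Qₛ.assoc a i b))
    (trans (cong (_⊹ b) (Qₛ.comm a i)) (Qₛ.assoc i a b)))) (Qₛ.assoc i (a ⊹ b) (neg c)))))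
    (sym (Qₛ.assoc i i _))))

⊟-solve : ∀ t d h → t ⊟ d ≡ h → d ≡ t ⊟ h
⊟-solve t d h eq = trans (sym (⊟-⊟ t d)) (cong (t ⊟_) eq)

rel-sum : ∀ d u t → u ⊟ (d ⊹ (u ⊟ t)) ≡ t ⊟ d
rel-sum d u t = begin
  u ⊟ s                  ≡⟨ cong (_⊟ s) (cancel′ u t) ⟨
  ((u ⊟ t) ⊹ t) ⊟ s      ≡⟨ cong (_⊟ s) (Qₛ.comm (u ⊟ t) t) ⟩
  (t ⊹ (u ⊟ t)) ⊟ s      ≡⟨ cong (λ r → (r ⊹ (u ⊟ t)) ⊟ s) (cancel′ t d) ⟨
  (((t ⊟ d) ⊹ d) ⊹ (u ⊟ t)) ⊟ s  ≡⟨ cong (_⊟ s) (Qₛ.assoc (t ⊟ d) d (u ⊟ t)) ⟩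
  ((t ⊟ d) ⊹ s) ⊟ s      ≡⟨ cancel (t ⊟ d) s ⟩
  t ⊟ d                  ∎
  where
  open ≡-Reasoning
  s : Q
  s = d ⊹ (u ⊟ t)

rel-zero : ∀ d u t → d ⊹ (u ⊟ t) ≡ 0F → t ⊟ d ≡ u
rel-zero d u t eq = trans (sym (rel-sum d u t)) (trans (cong (u ⊟_) eq)
  (trans (cong (_⊟ 0F) (sym (Qₛ.identityʳ u))) (cancel u 0F)))

avoid : (xs : Vec Q 8) → ∃[ q ] ∀ i → lookup xs i ≢ q
avoid xs with Finₚ.any? (λ q → Finₚ.all? (λ i → ¬? (lookup xs i Finₚ.≟ q)))
... | yes found = found
... | no ¬found = ⊥-elim (clash (Finₚ.pigeonhole (ℕₚ.m<m+n 8 (ℕ.s≤s ℕ.z≤n)) (proj₁ ∘ position)))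
  where
  position : ∀ q → ∃[ i ] lookup xs i ≡ q
  position q with Finₚ.any? (λ i → lookup xs i Finₚ.≟ q)
  ... | yes p = p
  ... | no ¬p = ⊥-elim (¬found (q , λ i eq → ¬p (i , eq)))
  clash : ∃[ q ] ∃[ q′ ] (q Fin.< q′ × proj₁ (position q) ≡ proj₁ (position q′)) → ⊥
  clash (q , q′ , q<q′ , eq) = Finₚ.<⇒≢ q<q′
    (trans (sym (proj₂ (position q))) (trans (cong (lookup xs) eq) (proj₂ (position q′))))

module Scale {ρ : ℤ → Q} (hom : IsHom ρ) (ρ-odd : odd (ρ 1ℤ) ≡ true) where
  open Hom {ρ} hom

  abstract
    at : Q → ℤ
    at q = proj₁ (preimage ρ-odd q)

    ρ-at : ∀ q → ρ (at q) ≡ q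
    ρ-at q = proj₂ (preimage ρ-odd q)

  ρ-difference : ∀ s t → ρ (s ℤ.- t) ≡ ρ s ⊟ ρ t
  ρ-difference s t = trans (hom s (ℤ.- t)) (cong (ρ s ⊹_) (ρ-neg t))

  -- Each G u agrees with F t for at least two of any three t with distinct residues, unless ρ u
  -- is one of a few residues.
  module Majority {F G : ℤ → Q}
    (law : ∀ t u → ρ u ≢ ρ t → G u ≡ F t ⊎ G u ≡ ρ t ⊎ F t ≡ ρ u) where
    private
      Votes : Q → Set
      Votes g = (g ≡ F (at 0F) ⊎ g ≡ 0F) × (g ≡ F (at 1F) ⊎ g ≡ 1F) × (g ≡ F (at 2F) ⊎ g ≡ 2F)

      -- Since g equals at most one of 0, 1, 2, it equals at least two of the three values of F. The
      -- same holds for g′, and two such pairs of indices have one in common.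
      votes-unique : ∀ {g g′} → Votes g → Votes g′ → g ≡ g′
      votes-unique (inj₁ p , _ , _) (inj₁ p′ , _ , _) = trans p (sym p′)
      votes-unique (_ , inj₁ p , _) (_ , inj₁ p′ , _) = trans p (sym p′)
      votes-unique (_ , _ , inj₁ p) (_ , _ , inj₁ p′) = trans p (sym p′)
      votes-unique (inj₂ refl , inj₂ () , _) _
      votes-unique (inj₂ refl , _ , inj₂ ()) _
      votes-unique (_ , inj₂ refl , inj₂ ()) _
      votes-unique _ (inj₂ refl , inj₂ () , _)
      votes-unique _ (inj₂ refl , _ , inj₂ ())
      votes-unique _ (_ , inj₂ refl , inj₂ ())

      law-at : ∀ q t u → ρ t ≡ q → ρ u ≢ q → F t ≢ ρ u → G u ≡ F t ⊎ G u ≡ q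
      law-at q t u refl u≢ F≢ with law t u u≢
      ... | inj₁ eq = inj₁ eq
      ... | inj₂ (inj₁ eq) = inj₂ eq
      ... | inj₂ (inj₂ eq) = ⊥-elim (F≢ eq)

      -- The residue of u is chosen so that the law applies to u with each of `at 0F`, `at 1F`,
      -- `at 2F` and t, and its third alternative fails each time. That excludes only eight of the
      -- sixteen residues.
      elect : ∀ t → ∃[ u ] (Votes (G u) × (G u ≡ F t ⊎ G u ≡ ρ t))
      elect t with avoid (0F ∷ F (at 0F) ∷ 1F ∷ F (at 1F) ∷ 2F ∷ F (at 2F) ∷ ρ t ∷ F t ∷ [])
      ... | q , q≢ = u , (vote 0F 0F 1F refl refl , vote 1F 2F 3F refl refl , vote 2F 4F 5F refl refl) ,
          law-at (ρ t) t u refl (λ eq → q≢ 6F (trans (sym eq) (ρ-at q))) (λ eq → q≢ 7F (trans eq (ρ-at q)))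
        where
        u : ℤ
        u = at q
        xs : Vec Q 8
        xs = 0F ∷ F (at 0F) ∷ 1F ∷ F (at 1F) ∷ 2F ∷ F (at 2F) ∷ ρ t ∷ F t ∷ []
        vote : ∀ r (i j : Fin 8) → lookup xs i ≡ r → lookup xs j ≡ F (at r) → G u ≡ F (at r) ⊎ G u ≡ r
        vote r i j ri rj = law-at r (at r) u (ρ-at r)
          (λ eq → q≢ i (trans ri (trans (sym eq) (ρ-at q)))) (λ eq → q≢ j (trans rj (trans eq (ρ-at q))))

    majority : ∃[ h ] ∀ t → F t ≡ h ⊎ ρ t ≡ h
    majority = G (proj₁ (elect 0ℤ)) , λ t → decide t (elect t)
      where
      decide : ∀ t → ∃[ u ] (Votes (G u) × (G u ≡ F t ⊎ G u ≡ ρ t)) →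
        F t ≡ G (proj₁ (elect 0ℤ)) ⊎ ρ t ≡ G (proj₁ (elect 0ℤ))
      decide t (u , votes , inj₁ eq) = inj₁ (trans (sym eq) (votes-unique votes (proj₁ (proj₂ (elect 0ℤ)))))
      decide t (u , votes , inj₂ eq) = inj₂ (trans (sym eq) (votes-unique votes (proj₁ (proj₂ (elect 0ℤ)))))

  Follows : (ℤ → Q) → Set
  Follows f = ∀ t → ρ t ≢ 0F → f t ≡ ρ t

  abstract
    -- The majority argument is applied to the defects F(t) = ρ(t) - D(t) and G(u) = ρ(u) - P(u).
    rescale-one : ∀ {D P : ℤ → Q} → (∀ t u → ρ u ≢ ρ t → Rel (P u) (D t) (ρ (u ℤ.- t))) →
      ∃[ h ] ∀ t → ρ t ≢ h → D t ≡ ρ t ⊟ h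
    rescale-one {D} {P} rel = let (h , dec) = majority in h , λ t ≢h → pick t ≢h (dec t)
      where
      law : ∀ t u → ρ u ≢ ρ t → ρ u ⊟ P u ≡ ρ t ⊟ D t ⊎ ρ u ⊟ P u ≡ ρ t ⊎ ρ t ⊟ D t ≡ ρ u
      law t u ≢ with subst (Rel (P u) (D t)) (ρ-difference u t) (rel t u ≢)
      ... | inj₁ eq = inj₁ (trans (cong (ρ u ⊟_) eq) (rel-sum (D t) (ρ u) (ρ t)))
      ... | inj₂ (inj₁ eq) = inj₂ (inj₁ (trans (cong (ρ u ⊟_) eq) (⊟-⊟ (ρ u) (ρ t))))
      ... | inj₂ (inj₂ eq) = inj₂ (inj₂ (rel-zero (D t) (ρ u) (ρ t) eq))
      open Majority {λ t → ρ t ⊟ D t} {λ u → ρ u ⊟ P u} law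
      pick : ∀ t {h} → ρ t ≢ h → ρ t ⊟ D t ≡ h ⊎ ρ t ≡ h → D t ≡ ρ t ⊟ h
      pick t ≢h (inj₁ eq) = ⊟-solve (ρ t) (D t) _ eq
      pick t ≢h (inj₂ eq) = ⊥-elim (≢h eq)

  record Solution : Set where
    field
      A B C A₁ B₁ C₁ : ℤ → Q
      rule : ∀ m n → Rules (A m) (B n) (C (m ℤ.+ n))
        (A₁ (m ℤ.+ + 16 ℤ.* n)) (B₁ (n ℤ.+ + 16 ℤ.* m)) (C₁ (m ℤ.- + 15 ℤ.* n))
      A-follows : Follows A
      B-follows : Follows B
      C-follows : Follows C

  module Descent (S : Solution) where
    open Solution S

    private
      nonzero : ∀ {t u} → ρ u ≢ ρ t → ρ (u ℤ.- t) ≢ 0F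
      nonzero {t} {u} ≢ eq = ≢ (⊟-≡0 (ρ u) (ρ t) (trans (sym (ρ-difference u t)) eq))

      on-line : ∀ {f} → Follows f → ∀ s t → ρ s ≢ 0F → f (16× t ℤ.+ s) ≡ ρ s
      on-line follows s t ≢0 = trans (follows _ (λ eq → ≢0 (trans (sym (ρ-16×+ s t)) eq))) (ρ-16×+ s t)

      -- Take m = 16 t and n = u - t. Then m + 16 n = 16 u, while B at n and C at m + n both equal
      -- the nonzero residue ρ(u - t), so the partner rule is in force.
      A-rel : ∀ t u → ρ u ≢ ρ t → Rel (A₁ (16× u)) (A (16× t)) (ρ (u ℤ.- t))
      A-rel t u ≢ = subst₂ (λ p b → Rel p (A (16× t)) b) (cong A₁ (place t u)) (B-follows _ (nonzero ≢))
        (A-partner (rule (16× t) (u ℤ.- t)) (trans (B-follows _ (nonzero ≢)) (sym (on-line C-follows _ t (nonzero ≢)))))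
        where
        place : ∀ t u → + 16 ℤ.* t ℤ.+ + 16 ℤ.* (u ℤ.- t) ≡ + 16 ℤ.* u
        place = solve-∀

      B-rel : ∀ t u → ρ u ≢ ρ t → Rel (B₁ (16× u)) (B (16× t)) (ρ (u ℤ.- t))
      B-rel t u ≢ = subst₂ (λ p a → Rel p (B (16× t)) a) (cong B₁ (place t u)) (A-follows _ (nonzero ≢))
        (B-partner (rule (u ℤ.- t) (16× t)) (trans (A-follows _ (nonzero ≢))
          (sym (trans (cong C (ℤₚ.+-comm (u ℤ.- t) (16× t))) (on-line C-follows _ t (nonzero ≢))))))
        where
        place : ∀ t u → + 16 ℤ.* t ℤ.+ + 16 ℤ.* (u ℤ.- t) ≡ + 16 ℤ.* u
        place = solve-∀

      -- Take m = 16 t + (u - t) and n = t - u. Then m + n = 16 t and m - 15 n = 16 u, and the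
      -- values of A and B are opposite.
      C-rel : ∀ t u → ρ u ≢ ρ t → Rel (C₁ (16× u)) (C (16× t)) (ρ (u ℤ.- t))
      C-rel t u ≢ = subst (Rel (C₁ (16× u)) (C (16× t))) A-value (subst₂ (λ p c → Rel p c (A (16× t ℤ.+ (u ℤ.- t))))
          (cong C₁ (place t u)) (cong C (sum t u))
          (C-partner (rule (16× t ℤ.+ (u ℤ.- t)) (t ℤ.- u)) (begin
            A (16× t ℤ.+ (u ℤ.- t)) ⊹ B (t ℤ.- u)   ≡⟨ cong₂ _⊹_ A-value B-value ⟩
            ρ (u ℤ.- t) ⊹ ρ (t ℤ.- u)               ≡⟨ hom (u ℤ.- t) (t ℤ.- u) ⟨
            ρ ((u ℤ.- t) ℤ.+ (t ℤ.- u))             ≡⟨ cong ρ (opposite t u) ⟩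
            ρ 0ℤ                                    ≡⟨ ρ-0 ⟩
            0F                                      ∎)))
        where
        open ≡-Reasoning
        A-value : A (16× t ℤ.+ (u ℤ.- t)) ≡ ρ (u ℤ.- t)
        A-value = on-line A-follows _ t (nonzero ≢)
        B-value : B (t ℤ.- u) ≡ ρ (t ℤ.- u)
        B-value = B-follows _ (nonzero (≢ ∘ sym))
        opposite : ∀ t u → (u ℤ.- t) ℤ.+ (t ℤ.- u) ≡ 0ℤ
        opposite = solve-∀
        sum : ∀ t u → (+ 16 ℤ.* t ℤ.+ (u ℤ.- t)) ℤ.+ (t ℤ.- u) ≡ + 16 ℤ.* t
        sum = solve-∀
        place : ∀ t u → (+ 16 ℤ.* t ℤ.+ (u ℤ.- t)) ℤ.- + 15 ℤ.* (t ℤ.- u) ≡ + 16 ℤ.* u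
        place = solve-∀

      hA hB hC : Q
      hA = proj₁ (rescale-one A-rel)
      hB = proj₁ (rescale-one B-rel)
      hC = proj₁ (rescale-one C-rel)

      A-off : ∀ t → ρ t ≢ hA → A (16× t) ≡ ρ t ⊟ hA
      A-off = proj₂ (rescale-one A-rel)
      B-off : ∀ t → ρ t ≢ hB → B (16× t) ≡ ρ t ⊟ hB
      B-off = proj₂ (rescale-one B-rel)
      C-off : ∀ t → ρ t ≢ hC → C (16× t) ≡ ρ t ⊟ hC
      C-off = proj₂ (rescale-one C-rel)

      -- Choose ρ(m) = i + hA and ρ(n) = i + hB. With δ = hA + hB - hC, the values of A, B, C at 16
      -- m, 16 n, 16 (m + n) are i, i, 2i + δ, and for the i from `generic` the addition rule forces
      -- δ = 0.
      hC≡ : hC ≡ hA ⊹ hB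
      hC≡ = sym (⊟-≡0 _ _ (conclude
          (subst₂ (λ a b → c ≡ a ⊹ b ⊎ a ⊹ b ≡ 0F ⊎ c ≡ a ⊎ c ≡ b) A-value B-value
            (subst (λ c → c ≡ A (16× m) ⊹ B (16× n) ⊎ A (16× m) ⊹ B (16× n) ≡ 0F ⊎ c ≡ A (16× m) ⊎ c ≡ B (16× n))
              C-value (addition (rule (16× m) (16× n)))))))
        where
        δ i : Q
        δ = (hA ⊹ hB) ⊟ hC
        i = proj₁ (generic δ)
        i≢0 : i ≢ 0F
        i≢0 = proj₁ (proj₂ (generic δ))
        c≢0 : (i ⊹ i) ⊹ δ ≢ 0F
        c≢0 = proj₁ (proj₂ (proj₂ (proj₂ (generic δ))))
        conclude : (i ⊹ i) ⊹ δ ≡ i ⊹ i ⊎ (i ⊹ i) ≡ 0F ⊎ (i ⊹ i) ⊹ δ ≡ i ⊎ (i ⊹ i) ⊹ δ ≡ i → δ ≡ 0F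
        conclude = proj₂ (proj₂ (proj₂ (proj₂ (generic δ))))
        m n : ℤ
        m = at (i ⊹ hA)
        n = at (i ⊹ hB)
        c : Q
        c = (i ⊹ i) ⊹ δ
        off : ∀ t h → ρ t ≡ i ⊹ h → ρ t ⊟ h ≡ i
        off t h eq = trans (cong (_⊟ h) eq) (cancel i h)
        apart : ∀ t h {j} → ρ t ⊟ h ≡ j → j ≢ 0F → ρ t ≢ h
        apart t h refl j≢0 refl = j≢0 (Qₛ.inverseʳ (ρ t))
        A-value : A (16× m) ≡ i
        A-value = trans (A-off m (apart m hA (off m hA (ρ-at _)) i≢0)) (off m hA (ρ-at _))
        B-value : B (16× n) ≡ i
        B-value = trans (B-off n (apart n hB (off n hB (ρ-at _)) i≢0)) (off n hB (ρ-at _))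
        ρ-sum : ρ (m ℤ.+ n) ⊟ hC ≡ c
        ρ-sum = trans (cong (_⊟ hC) (trans (hom m n) (cong₂ _⊹_ (ρ-at _) (ρ-at _)))) (regroup i hA hB hC)
        C-value : C (16× m ℤ.+ 16× n) ≡ c
        C-value = trans (cong C (16×-+ m n)) (trans (C-off (m ℤ.+ n) (apart (m ℤ.+ n) hC ρ-sum c≢0)) ρ-sum)

      α β : ℤ
      α = at hA
      β = at hB

      follows-off : ∀ {f : ℤ → Q} {h} s → ρ s ≡ h → (∀ t → ρ t ≢ h → f (16× t) ≡ ρ t ⊟ h) →
        Follows (λ t → f (16× (t ℤ.+ s)))
      follows-off {f} s refl off t t≢0 = trans
        (off (t ℤ.+ s) (λ eq → t≢0 (Qₚ.identityˡ-unique (ρ t) (ρ s) (trans (sym (hom t s)) eq))))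
        (trans (cong (_⊟ ρ s) (hom t s)) (cancel (ρ t) (ρ s)))

    offset : ℤ
    offset = α

    private
      sum : ∀ m n α β → + 16 ℤ.* (m ℤ.+ α) ℤ.+ + 16 ℤ.* (n ℤ.+ β) ≡ + 16 ℤ.* (m ℤ.+ n ℤ.+ (α ℤ.+ β))
      sum = solve-∀
      partner : ∀ m n α β → + 16 ℤ.* (m ℤ.+ α) ℤ.+ + 16 ℤ.* (+ 16 ℤ.* (n ℤ.+ β)) ≡
        + 16 ℤ.* (m ℤ.+ + 16 ℤ.* n ℤ.+ (α ℤ.+ + 16 ℤ.* β))
      partner = solve-∀
      partner′ : ∀ m n α β → + 16 ℤ.* (m ℤ.+ α) ℤ.- + 15 ℤ.* (+ 16 ℤ.* (n ℤ.+ β)) ≡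
        + 16 ℤ.* (m ℤ.- + 15 ℤ.* n ℤ.+ (α ℤ.- + 15 ℤ.* β))
      partner′ = solve-∀

      -- The plane is rescaled by 16 after moving the origin to (α , β), where ρ(α) = hA and ρ(β) =
      -- hB. Each function is shifted by the value of its form at (α , β); for C this removes hC
      -- because hC = hA + hB.
      A′ B′ C′ A₁′ B₁′ C₁′ : ℤ → Q
      A′ t = A (16× (t ℤ.+ α))
      B′ t = B (16× (t ℤ.+ β))
      C′ t = C (16× (t ℤ.+ (α ℤ.+ β)))
      A₁′ t = A₁ (16× (t ℤ.+ (α ℤ.+ + 16 ℤ.* β)))
      B₁′ t = B₁ (16× (t ℤ.+ (β ℤ.+ + 16 ℤ.* α)))
      C₁′ t = C₁ (16× (t ℤ.+ (α ℤ.- + 15 ℤ.* β)))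

      rule′ : ∀ m n → Rules (A′ m) (B′ n) (C′ (m ℤ.+ n))
        (A₁′ (m ℤ.+ + 16 ℤ.* n)) (B₁′ (n ℤ.+ + 16 ℤ.* m)) (C₁′ (m ℤ.- + 15 ℤ.* n))
      rule′ m n = rules-cong refl refl (cong C (sum m n α β)) (cong A₁ (partner m n α β))
        (cong B₁ (partner n m β α)) (cong C₁ (partner′ m n α β)) (rule (16× (m ℤ.+ α)) (16× (n ℤ.+ β)))

      A′-follows : Follows A′
      A′-follows = follows-off {A} {hA} α (ρ-at hA) A-off
      B′-follows : Follows B′
      B′-follows = follows-off {B} {hB} β (ρ-at hB) B-off
      C′-follows : Follows C′
      C′-follows = follows-off {C} {hC} (α ℤ.+ β)
        (trans (hom α β) (trans (cong₂ _⊹_ (ρ-at hA) (ρ-at hB)) (sym hC≡))) C-off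

    descend : Solution
    descend = record
      { A = A′ ; B = B′ ; C = C′ ; A₁ = A₁′ ; B₁ = B₁′ ; C₁ = C₁′
      ; rule = rule′ ; A-follows = A′-follows ; B-follows = B′-follows ; C-follows = C′-follows }

  -- Take t with ρ(t) and ρ(t + k) both nonzero; there f coincides with ρ at both points, so ρ(t) =
  -- ρ(t + k).
  follows-period : ∀ {f} → Follows f → ∀ k → (∀ t → f (t ℤ.+ k) ≡ f t) → ρ k ≡ 0F
  follows-period {f} follows k periodic with both-nonzero (ρ k)
  ... | i , i≢0 , i+k≢0 = Qₚ.identityʳ-unique i (ρ k) (begin
    i ⊹ ρ k      ≡⟨ ρ-sum ⟨
    ρ (t ℤ.+ k)  ≡⟨ follows _ (λ eq → i+k≢0 (trans (sym ρ-sum) eq)) ⟨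
    f (t ℤ.+ k)  ≡⟨ periodic t ⟩
    f t          ≡⟨ follows _ (λ eq → i≢0 (trans (sym (ρ-at i)) eq)) ⟩
    ρ t          ≡⟨ ρ-at i ⟩
    i            ∎)
    where
    open ≡-Reasoning
    t : ℤ
    t = at i
    ρ-sum : ρ (t ℤ.+ k) ≡ i ⊹ ρ k
    ρ-sum = trans (hom t k) (cong (_⊹ ρ k) (ρ-at i))

  not-periodic : (S : Solution) → ∀ k → (∀ t → Solution.A S (t ℤ.+ + suc k) ≡ Solution.A S t) → ⊥
  not-periodic S k = go S k (<-wellFounded k)
    where
    go : (S : Solution) → ∀ k → Acc ℕ._<_ k → (∀ t → Solution.A S (t ℤ.+ + suc k) ≡ Solution.A S t) → ⊥
    go S k (acc rec) periodic
      with kernel ρ-odd (+ suc k) (follows-period (Solution.A-follows S) (+ suc k) periodic)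
    ... | + zero , ()
    ... | ℤ.-[1+ _ ] , ()
    -- The period `suc k` is 16 times `suc k′`, so the rescaled solution has the smaller period
    -- `suc k′`.
    ... | + suc k′ , eq = go (Descent.descend S) k′ (rec k′<k) λ t →
      trans (cong (Solution.A S) (move t (+ suc k′) (Descent.offset S)))
        (trans (cong (λ l → Solution.A S (16× (t ℤ.+ Descent.offset S) ℤ.+ l)) (sym eq)) (periodic _))
      where
      move : ∀ t k o → + 16 ℤ.* (t ℤ.+ k ℤ.+ o) ≡ + 16 ℤ.* (t ℤ.+ o) ℤ.+ + 16 ℤ.* k
      move = solve-∀
      k′<k : k′ ℕ.< k
      k′<k = ℕₚ.≤-pred (subst (suc (suc k′) ℕ.≤_) (sym (trans (ℤₚ.+-injective eq) (ℕₚ.*-comm 16 (suc k′))))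
        (ℕₚ.m<m*n (suc k′) 16 (ℕ.s≤s (ℕ.s≤s ℕ.z≤n))))

-- The aperiodic constraint

-- The symbols 0, …, 5 are digits of the forms below and 6, 7, 8 are clocks modulo 16.
Symbol : Set
Symbol = Fin 9

form : Symbol → ℤ → ℤ → ℤ
form 0F m n = m
form 1F m n = n
form 2F m n = m ℤ.+ n
form 3F m n = m ℤ.+ + 16 ℤ.* n
form 4F m n = n ℤ.+ + 16 ℤ.* m
form 5F m n = m ℤ.- + 15 ℤ.* n
form 6F m n = m
form 7F m n = n
form 8F m n = m ℤ.+ n

-- A generator of the kernel of `form j`, so that being constant in this direction means being a
-- function of the form.
direction : Symbol → ℤ × ℤ
direction 0F = 0ℤ , 1ℤ
direction 1F = 1ℤ , 0ℤ
direction 2F = 1ℤ , ℤ.- 1ℤ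
direction 3F = + 16 , ℤ.- 1ℤ
direction 4F = 1ℤ , ℤ.- (+ 16)
direction 5F = + 15 , 1ℤ
direction 6F = 0ℤ , 1ℤ
direction 7F = 1ℤ , 0ℤ
direction 8F = 1ℤ , ℤ.- 1ℤ

direction≢0 : ∀ j → direction j ≢ (0ℤ , 0ℤ)
direction≢0 0F ()
direction≢0 1F ()
direction≢0 2F ()
direction≢0 3F ()
direction≢0 4F ()
direction≢0 5F ()
direction≢0 6F ()
direction≢0 7F ()
direction≢0 8F ()

-- Additivity of the clocks makes them affine with a common slope, the parity condition makes this
-- slope odd, and agreement of digits with nonzero clocks is the initial `Follows`.
Legal : Bool → (Symbol → Q) → Set
Legal h s = Rules (s 0F) (s 1F) (s 2F) (s 3F) (s 4F) (s 5F) × s 6F ⊹ s 7F ≡ s 8F ×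
  (s 6F ≢ 0F → s 0F ≡ s 6F) × (s 7F ≢ 0F → s 1F ≡ s 7F) × (s 8F ≢ 0F → s 2F ≡ s 8F) × odd (s 6F) ≡ not h

legal? : ∀ h s → Dec (Legal h s)
legal? h s = rules? _ _ _ _ _ _ ×-dec ((s 6F ⊹ s 7F Finₚ.≟ s 8F) ×-dec
  ((¬? (s 6F Finₚ.≟ 0F) →-dec (s 0F Finₚ.≟ s 6F)) ×-dec ((¬? (s 7F Finₚ.≟ 0F) →-dec (s 1F Finₚ.≟ s 7F)) ×-dec
  ((¬? (s 8F Finₚ.≟ 0F) →-dec (s 2F Finₚ.≟ s 8F)) ×-dec (odd (s 6F) Boolₚ.≟ not h)))))

invariant : ∀ (f : ℤ → ℤ → Q) a b → (∀ x y → f (x ℤ.+ a) (y ℤ.+ b) ≡ f x y) →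
  ∀ k x y → f (x ℤ.+ k ℤ.* a) (y ℤ.+ k ℤ.* b) ≡ f x y
invariant f a b inv (+ n) = up n
  where
  up : ∀ n x y → f (x ℤ.+ + n ℤ.* a) (y ℤ.+ + n ℤ.* b) ≡ f x y
  up zero x y = cong₂ f (zeroes x a) (zeroes y b)
    where
    zeroes : ∀ x a → x ℤ.+ 0ℤ ℤ.* a ≡ x
    zeroes = solve-∀
  up (suc n) x y = trans (cong₂ f (next-step x (+ n) a) (next-step y (+ n) b)) (trans (up n _ _) (inv x y))
    where
    next-step : ∀ x n a → x ℤ.+ (1ℤ ℤ.+ n) ℤ.* a ≡ x ℤ.+ a ℤ.+ n ℤ.* a
    next-step = solve-∀
invariant f a b inv (ℤ.-[1+ n ]) x y = trans (sym (invariant f a b inv (+ suc n) _ _))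
  (cong₂ f (back x (+ suc n) a) (back y (+ suc n) b))
  where
  back : ∀ x k a → x ℤ.+ (ℤ.- k) ℤ.* a ℤ.+ k ℤ.* a ≡ x
  back = solve-∀

-- The restriction to an axis on which form j is the coordinate.
on-axis : Symbol → (ℤ → ℤ → Q) → ℤ → Q
on-axis 1F f t = f 0ℤ t
on-axis 4F f t = f 0ℤ t
on-axis 7F f t = f 0ℤ t
on-axis _ f t = f t 0ℤ

-- A suitable multiple of the direction leads from (m , n) to the axis without changing the form.
factors : ∀ j f → (∀ x y → f (x ℤ.+ proj₁ (direction j)) (y ℤ.+ proj₂ (direction j)) ≡ f x y) →
  ∀ m n → f m n ≡ on-axis j f (form j m n)
factors 0F f inv m n = trans (sym (invariant f _ _ inv (ℤ.- n) m n)) (cong₂ f (p m n) (q n))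
  where
  p : ∀ m n → m ℤ.+ (ℤ.- n) ℤ.* 0ℤ ≡ m
  p = solve-∀
  q : ∀ n → n ℤ.+ (ℤ.- n) ℤ.* 1ℤ ≡ 0ℤ
  q = solve-∀
factors 6F f inv m n = factors 0F f inv m n
factors 1F f inv m n = trans (sym (invariant f _ _ inv (ℤ.- m) m n)) (cong₂ f (p m) (q m n))
  where
  p : ∀ m → m ℤ.+ (ℤ.- m) ℤ.* 1ℤ ≡ 0ℤ
  p = solve-∀
  q : ∀ m n → n ℤ.+ (ℤ.- m) ℤ.* 0ℤ ≡ n
  q = solve-∀
factors 7F f inv m n = factors 1F f inv m n
factors 2F f inv m n = trans (sym (invariant f _ _ inv n m n)) (cong₂ f (p m n) (q n))
  where
  p : ∀ m n → m ℤ.+ n ℤ.* 1ℤ ≡ m ℤ.+ n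
  p = solve-∀
  q : ∀ n → n ℤ.+ n ℤ.* (ℤ.- 1ℤ) ≡ 0ℤ
  q = solve-∀
factors 8F f inv m n = factors 2F f inv m n
factors 3F f inv m n = trans (sym (invariant f _ _ inv n m n)) (cong₂ f (p m n) (q n))
  where
  p : ∀ m n → m ℤ.+ n ℤ.* + 16 ≡ m ℤ.+ + 16 ℤ.* n
  p = solve-∀
  q : ∀ n → n ℤ.+ n ℤ.* (ℤ.- 1ℤ) ≡ 0ℤ
  q = solve-∀
factors 4F f inv m n = trans (sym (invariant f _ _ inv (ℤ.- m) m n)) (cong₂ f (p m) (q m n))
  where
  p : ∀ m → m ℤ.+ (ℤ.- m) ℤ.* 1ℤ ≡ 0ℤ
  p = solve-∀
  q : ∀ m n → n ℤ.+ (ℤ.- m) ℤ.* (ℤ.- (+ 16)) ≡ n ℤ.+ + 16 ℤ.* m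
  q = solve-∀
factors 5F f inv m n = trans (sym (invariant f _ _ inv (ℤ.- n) m n)) (cong₂ f (p m n) (q n))
  where
  p : ∀ m n → m ℤ.+ (ℤ.- n) ℤ.* + 15 ≡ m ℤ.- + 15 ℤ.* n
  p = solve-∀
  q : ∀ n → n ℤ.+ (ℤ.- n) ℤ.* 1ℤ ≡ 0ℤ
  q = solve-∀

form-direction : ∀ j m n → form j (m ℤ.+ proj₁ (direction j)) (n ℤ.+ proj₂ (direction j)) ≡ form j m n
form-direction 0F = λ m n → ℤₚ.+-identityʳ m
form-direction 6F = λ m n → ℤₚ.+-identityʳ m
form-direction 1F = λ m n → ℤₚ.+-identityʳ n
form-direction 7F = λ m n → ℤₚ.+-identityʳ n
form-direction 2F = p
  where
  p : ∀ m n → m ℤ.+ 1ℤ ℤ.+ (n ℤ.+ ℤ.- 1ℤ) ≡ m ℤ.+ n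
  p = solve-∀
form-direction 8F = form-direction 2F
form-direction 3F = p
  where
  p : ∀ m n → m ℤ.+ + 16 ℤ.+ + 16 ℤ.* (n ℤ.+ ℤ.- 1ℤ) ≡ m ℤ.+ + 16 ℤ.* n
  p = solve-∀
form-direction 4F = p
  where
  p : ∀ m n → n ℤ.+ ℤ.- (+ 16) ℤ.+ + 16 ℤ.* (m ℤ.+ 1ℤ) ≡ n ℤ.+ + 16 ℤ.* m
  p = solve-∀
form-direction 5F = p
  where
  p : ∀ m n → m ℤ.+ + 15 ℤ.- + 15 ℤ.* (n ℤ.+ 1ℤ) ≡ m ℤ.- + 15 ℤ.* n
  p = solve-∀

difference-unique : ∀ {a b c d : Q} → a ⊹ b ≡ c ⊹ d → a ⊟ c ≡ d ⊟ b
difference-unique {a} {b} {c} {d} eq = begin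
  a ⊟ c              ≡⟨ cong (_⊟ c) (cancel a b) ⟨
  ((a ⊹ b) ⊟ b) ⊟ c  ≡⟨ cong (λ e → (e ⊟ b) ⊟ c) (trans eq (Qₛ.comm c d)) ⟩
  ((d ⊹ c) ⊟ b) ⊟ c  ≡⟨ Qₛ.assoc (d ⊹ c) (neg b) (neg c) ⟩
  (d ⊹ c) ⊹ (neg b ⊹ neg c)  ≡⟨ cong ((d ⊹ c) ⊹_) (Qₛ.comm (neg b) (neg c)) ⟩
  (d ⊹ c) ⊹ (neg c ⊹ neg b)  ≡⟨ Qₛ.assoc (d ⊹ c) (neg c) (neg b) ⟨
  ((d ⊹ c) ⊟ c) ⊟ b  ≡⟨ cong (_⊟ b) (cancel d c) ⟩
  d ⊟ b              ∎
  where open ≡-Reasoning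

-- Legal fields start the descent

module Forced (S : ℤ → ℤ → Symbol → Q) (h : ℤ → ℤ → Bool)
  (constant : ∀ x y j → S (x ℤ.+ proj₁ (direction j)) (y ℤ.+ proj₂ (direction j)) j ≡ S x y j)
  (alternate : ∀ x y → h (x ℤ.+ 1ℤ) y ≡ not (h x y))
  (legal : ∀ x y → Legal (h x y) (S x y)) where
  private
    s : Symbol → ℤ → Q
    s j = on-axis j (λ x y → S x y j)

    S≡s : ∀ j m n → S m n j ≡ s j (form j m n)
    S≡s j = factors j (λ x y → S x y j) (λ x y → constant x y j)

    X Y Z ρ : ℤ → Q
    X = s 6F
    Y = s 7F
    Z = s 8F
    ρ t = X t ⊟ X 0ℤ

    X+Y : ∀ m n → X m ⊹ Y n ≡ Z (m ℤ.+ n)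
    X+Y m n = trans (sym (cong₂ _⊹_ (S≡s 6F m n) (S≡s 7F m n)))
      (trans (proj₁ (proj₂ (legal m n))) (S≡s 8F m n))

    Y-ρ : ∀ t → Y t ⊟ Y 0ℤ ≡ ρ t
    Y-ρ t = sym (difference-unique (trans (X+Y t 0ℤ) (trans
      (cong Z (ℤₚ.+-comm t 0ℤ)) (sym (X+Y 0ℤ t)))))

    -- X(m) + Y(n) depends only on m + n, so an increment of X over a step t equals the increment of
    -- Y from 0 to t, which is ρ(t) wherever the step is made.
    ρ-hom : IsHom ρ
    ρ-hom s t = begin
      X (s ℤ.+ t) ⊟ X 0ℤ                ≡⟨ cong (_⊟ X 0ℤ) (cancel′ (X (s ℤ.+ t)) (X s)) ⟨
      ((X (s ℤ.+ t) ⊟ X s) ⊹ X s) ⊟ X 0ℤ  ≡⟨ Qₛ.assoc (X (s ℤ.+ t) ⊟ X s) (X s) (neg (X 0ℤ)) ⟩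
      (X (s ℤ.+ t) ⊟ X s) ⊹ ρ s         ≡⟨ cong (_⊹ ρ s) (difference-unique (trans (X+Y (s ℤ.+ t) 0ℤ)
                                             (trans (cong Z (ℤₚ.+-identityʳ (s ℤ.+ t))) (sym (X+Y s t))))) ⟩
      (Y t ⊟ Y 0ℤ) ⊹ ρ s                ≡⟨ cong (_⊹ ρ s) (Y-ρ t) ⟩
      ρ t ⊹ ρ s                         ≡⟨ Qₛ.comm (ρ t) (ρ s) ⟩
      ρ s ⊹ ρ t                         ∎
      where open ≡-Reasoning

    X-odd : ∀ x → odd (X x) ≡ not (h x 0ℤ)
    X-odd x = proj₂ (proj₂ (proj₂ (proj₂ (proj₂ (legal x 0ℤ)))))

    ρ-odd : odd (ρ 1ℤ) ≡ true
    ρ-odd = odd-difference (X 0ℤ) (X 1ℤ)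
      (trans (X-odd 1ℤ) (cong not (trans (alternate 0ℤ 0ℤ) (sym (X-odd 0ℤ)))))

    open Hom {ρ} ρ-hom using (preimage)
    open Scale {ρ} ρ-hom ρ-odd

    -- Preimages of -X(0) and -Y(0): moving the origin to (α , β) turns the three affine clocks into
    -- ρ itself.
    α β : ℤ
    α = proj₁ (preimage ρ-odd (neg (X 0ℤ)))
    β = proj₁ (preimage ρ-odd (neg (Y 0ℤ)))

    X-α : ∀ t → X (t ℤ.+ α) ≡ ρ t
    X-α t = begin
      X (t ℤ.+ α)                 ≡⟨ cancel′ (X (t ℤ.+ α)) (X 0ℤ) ⟨
      ρ (t ℤ.+ α) ⊹ X 0ℤ          ≡⟨ cong (_⊹ X 0ℤ) (trans (ρ-hom t α) (cong (ρ t ⊹_) (proj₂ (preimage ρ-odd _)))) ⟩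
      (ρ t ⊹ neg (X 0ℤ)) ⊹ X 0ℤ   ≡⟨ cancel′ (ρ t) (X 0ℤ) ⟩
      ρ t                         ∎
      where open ≡-Reasoning

    Y-β : ∀ t → Y (t ℤ.+ β) ≡ ρ t
    Y-β t = begin
      Y (t ℤ.+ β)                 ≡⟨ cancel′ (Y (t ℤ.+ β)) (Y 0ℤ) ⟨
      (Y (t ℤ.+ β) ⊟ Y 0ℤ) ⊹ Y 0ℤ ≡⟨ cong (_⊹ Y 0ℤ) (trans (Y-ρ (t ℤ.+ β)) (trans (ρ-hom t β)
                                       (cong (ρ t ⊹_) (proj₂ (preimage ρ-odd _))))) ⟩
      (ρ t ⊹ neg (Y 0ℤ)) ⊹ Y 0ℤ   ≡⟨ cancel′ (ρ t) (Y 0ℤ) ⟩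
      ρ t                         ∎
      where open ≡-Reasoning

    Z-αβ : ∀ t → Z (t ℤ.+ (α ℤ.+ β)) ≡ ρ t
    Z-αβ t = begin
      Z (t ℤ.+ (α ℤ.+ β))         ≡⟨ cong Z (reorder t α β) ⟩
      Z ((t ℤ.+ α) ℤ.+ (0ℤ ℤ.+ β))  ≡⟨ X+Y (t ℤ.+ α) (0ℤ ℤ.+ β) ⟨
      X (t ℤ.+ α) ⊹ Y (0ℤ ℤ.+ β)  ≡⟨ cong₂ _⊹_ (X-α t) (trans (Y-β 0ℤ) (Qₛ.inverseʳ (X 0ℤ))) ⟩
      ρ t ⊹ 0F                    ≡⟨ Qₛ.identityʳ (ρ t) ⟩
      ρ t                         ∎
      where
      open ≡-Reasoning
      reorder : ∀ t a b → t ℤ.+ (a ℤ.+ b) ≡ (t ℤ.+ a) ℤ.+ (0ℤ ℤ.+ b)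
      reorder = solve-∀

    follow : ∀ {c : ℤ → Q} j k d → (∀ t → c (t ℤ.+ d) ≡ ρ t) → (∀ t → c t ≢ 0F → s j t ≡ s k t) → s k ≡ c →
      Follows (λ t → s j (t ℤ.+ d))
    follow j k d c-d agree refl t ≢0 = trans (agree (t ℤ.+ d) (λ eq → ≢0 (trans (sym (c-d t)) eq))) (c-d t)

    A B C A₁ B₁ C₁ : ℤ → Q
    A t = s 0F (t ℤ.+ α)
    B t = s 1F (t ℤ.+ β)
    C t = s 2F (t ℤ.+ (α ℤ.+ β))
    A₁ t = s 3F (t ℤ.+ (α ℤ.+ + 16 ℤ.* β))
    B₁ t = s 4F (t ℤ.+ (β ℤ.+ + 16 ℤ.* α))
    C₁ t = s 5F (t ℤ.+ (α ℤ.- + 15 ℤ.* β))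

    rule : ∀ m n → Rules (A m) (B n) (C (m ℤ.+ n))
      (A₁ (m ℤ.+ + 16 ℤ.* n)) (B₁ (n ℤ.+ + 16 ℤ.* m)) (C₁ (m ℤ.- + 15 ℤ.* n))
    rule m n = rules-cong (S≡s 0F x y) (S≡s 1F x y)
        (trans (S≡s 2F x y) (cong (s 2F) (sum m n α β))) (trans (S≡s 3F x y) (cong (s 3F) (partner m n α β)))
        (trans (S≡s 4F x y) (cong (s 4F) (partner n m β α))) (trans (S≡s 5F x y) (cong (s 5F) (partner′ m n α β)))
        (proj₁ (legal x y))
      where
      x y : ℤ
      x = m ℤ.+ α
      y = n ℤ.+ β
      sum : ∀ m n α β → (m ℤ.+ α) ℤ.+ (n ℤ.+ β) ≡ m ℤ.+ n ℤ.+ (α ℤ.+ β)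
      sum = solve-∀
      partner : ∀ m n α β → (m ℤ.+ α) ℤ.+ + 16 ℤ.* (n ℤ.+ β) ≡ m ℤ.+ + 16 ℤ.* n ℤ.+ (α ℤ.+ + 16 ℤ.* β)
      partner = solve-∀
      partner′ : ∀ m n α β → (m ℤ.+ α) ℤ.- + 15 ℤ.* (n ℤ.+ β) ≡ m ℤ.- + 15 ℤ.* n ℤ.+ (α ℤ.- + 15 ℤ.* β)
      partner′ = solve-∀

    C-agree : ∀ t → Z t ≢ 0F → s 2F t ≡ Z t
    C-agree t = proj₁ (proj₂ (proj₂ (proj₂ (proj₂ (legal t 0ℤ)))))

    A-follows : Follows A
    A-follows = follow 0F 6F α X-α (λ t → proj₁ (proj₂ (proj₂ (legal t 0ℤ)))) refl
    B-follows : Follows B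
    B-follows = follow 1F 7F β Y-β (λ t → proj₁ (proj₂ (proj₂ (proj₂ (legal 0ℤ t))))) refl
    C-follows : Follows C
    C-follows = follow 2F 8F (α ℤ.+ β) Z-αβ C-agree refl

    solution : Solution
    solution = record
      { A = A ; B = B ; C = C ; A₁ = A₁ ; B₁ = B₁ ; C₁ = C₁
      ; rule = rule ; A-follows = A-follows ; B-follows = B-follows ; C-follows = C-follows }

  aperiodic : ∀ k → (∀ x y j → S (x ℤ.+ + suc k) y j ≡ S x y j) → ⊥
  aperiodic k periodic = not-periodic solution k λ t →
    trans (cong (s 0F) (swap t (+ suc k) α)) (periodic (t ℤ.+ α) 0ℤ 0F)
    where
    swap : ∀ t k a → t ℤ.+ k ℤ.+ a ≡ t ℤ.+ a ℤ.+ k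
    swap = solve-∀

-- A legal field from digits

affine≢0 : ∀ r → ¬ (3 ∣ ℤ.∣ r ∣) → ∀ t → + 3 ℤ.* t ℤ.+ r ≢ 0ℤ
affine≢0 r 3∤r t eq = 3∤r (divides ℤ.∣ t ∣ (begin
  ℤ.∣ r ∣                ≡⟨ ℤₚ.∣-i∣≡∣i∣ r ⟨
  ℤ.∣ ℤ.- r ∣            ≡⟨ cong ℤ.∣_∣ (trans (sym (ℤₚ.+-identityˡ (ℤ.- r)))
                             (trans (cong (ℤ._- r) (sym eq)) (isolate t r))) ⟩
  ℤ.∣ + 3 ℤ.* t ∣        ≡⟨ ℤₚ.abs-* (+ 3) t ⟩
  3 ℕ.* ℤ.∣ t ∣          ≡⟨ ℕₚ.*-comm 3 ℤ.∣ t ∣ ⟩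
  ℤ.∣ t ∣ ℕ.* 3          ∎))
  where
  open ≡-Reasoning
  isolate : ∀ t r → (+ 3 ℤ.* t ℤ.+ r) ℤ.- r ≡ + 3 ℤ.* t
  isolate = solve-∀

-- Since 3 divides none of the constants, no form of 3 m + 1 and 3 n + 1 vanishes.
shift-of : Symbol → ℤ
shift-of 0F = + 1
shift-of 1F = + 1
shift-of 2F = + 2
shift-of 3F = + 17
shift-of 4F = + 17
shift-of 5F = ℤ.- (+ 14)
shift-of 6F = + 1
shift-of 7F = + 1
shift-of 8F = + 2

3∤shift : ∀ j → ¬ (3 ∣ ℤ.∣ shift-of j ∣)
3∤shift = from-yes (Finₚ.all? λ j → ¬? (3 ∣? ℤ.∣ shift-of j ∣))

argument : Symbol → ℤ → ℤ
argument j t = + 3 ℤ.* t ℤ.+ shift-of j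

abstract
  the-digit : Symbol → ℤ → Q
  the-digit j t = proj₁ (digit (argument j t) (affine≢0 (shift-of j) (3∤shift j) t))

  is-digit : ∀ j t → Digit (argument j t) (the-digit j t)
  is-digit j t = proj₂ (digit (argument j t) (affine≢0 (shift-of j) (3∤shift j) t))

symbol : Symbol → ℤ → Q
symbol 6F t = residue (argument 6F t)
symbol 7F t = residue (argument 7F t)
symbol 8F t = residue (argument 8F t)
symbol j t = the-digit j t

-- A wave of period 4, true on 0, 1 and false on 2, 3. The sum of neighbouring values is the
-- alternating bit, so it can serve as β in `field-map`.
half : Q → Bool
half q = ⌊ toℕ q ℕ.% 4 ℕ.<? 2 ⌋

opaque
  unfolding _⊹_

  half-alternate : ∀ q → half ((q ⊹ (1F ⊹ 0F)) ⊹ (1F ⊹ 0F)) ≡ not (half q)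
  half-alternate = from-yes (Finₚ.all? λ q → half ((q ⊹ (1F ⊹ 0F)) ⊹ (1F ⊹ 0F)) Boolₚ.≟ not (half q))

  -- 3q + 1 is odd just if q is even, and `half` changes from q to q + 1 just if q is odd.
  odd-half : ∀ q → odd (((q ⊹ q) ⊹ q) ⊹ (1F ⊹ 0F)) ≡ not (half q xor half (q ⊹ (1F ⊹ 0F)))
  odd-half = from-yes (Finₚ.all? λ q →
    odd (((q ⊹ q) ⊹ q) ⊹ (1F ⊹ 0F)) Boolₚ.≟ not (half q xor half (q ⊹ (1F ⊹ 0F))))

residue-3 : ∀ x → residue (+ 3 ℤ.* x ℤ.+ 1ℤ) ≡ ((residue x ⊹ residue x) ⊹ residue x) ⊹ residue 1ℤ
residue-3 x = trans (cong residue (expand x)) (trans (residue-hom (x ℤ.+ x ℤ.+ x) 1ℤ)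
  (cong (_⊹ residue 1ℤ) (trans (residue-hom (x ℤ.+ x) x) (cong (_⊹ residue x) (residue-hom x x)))))
  where
  expand : ∀ x → + 3 ℤ.* x ℤ.+ 1ℤ ≡ x ℤ.+ x ℤ.+ x ℤ.+ 1ℤ
  expand = solve-∀

wave : ℤ → Bool
wave x = half (residue x)

wave-alternate : ∀ x → wave (x ℤ.+ 1ℤ ℤ.+ 1ℤ) ≡ not (wave x)
wave-alternate x = trans (cong half (trans (residue-hom (x ℤ.+ 1ℤ) 1ℤ) (cong (_⊹ residue 1ℤ) (residue-hom x 1ℤ))))
  (half-alternate (residue x))

digits-rules : ∀ x y → Rules (symbol 0F (form 0F x y)) (symbol 1F (form 1F x y)) (symbol 2F (form 2F x y))
  (symbol 3F (form 3F x y)) (symbol 4F (form 4F x y)) (symbol 5F (form 5F x y))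
digits-rules x y = rules
  (partner-rule (is-digit 0F x) (is-digit 1F y) (at (sum x y) (is-digit 2F (x ℤ.+ y)))
    (at (partner x y) (is-digit 3F (x ℤ.+ + 16 ℤ.* y))))
  (partner-rule (is-digit 1F y) (is-digit 0F x) (at (sum′ x y) (is-digit 2F (x ℤ.+ y)))
    (at (partner y x) (is-digit 4F (y ℤ.+ + 16 ℤ.* x))))
  -- The partner rule with M = 3(x + y) + 2 and β = -(3y + 1): the digit of β is -b = a, and M + β =
  -- 3x + 1 also has digit a.
  (λ a+b≡0 → let a≡-b = Qₚ.inverseˡ-unique (the-digit 0F x) (the-digit 1F y) a+b≡0 in
    subst (Rel (the-digit 5F (x ℤ.- + 15 ℤ.* y)) (the-digit 2F (x ℤ.+ y))) (sym a≡-b)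
      (partner-rule (is-digit 2F (x ℤ.+ y)) (digit-neg (is-digit 1F y)) (at (difference x y) (is-digit 0F x))
        (at (partner′ x y) (is-digit 5F (x ℤ.- + 15 ℤ.* y))) (sym a≡-b)))
  (addition-rule (is-digit 0F x) (is-digit 1F y) (at (sum x y) (is-digit 2F (x ℤ.+ y))))
  where
  at : ∀ {t u d} → u ≡ t → Digit t d → Digit u d
  at refl δ = δ
  sum : ∀ x y → + 3 ℤ.* x ℤ.+ + 1 ℤ.+ (+ 3 ℤ.* y ℤ.+ + 1) ≡ + 3 ℤ.* (x ℤ.+ y) ℤ.+ + 2
  sum = solve-∀
  sum′ : ∀ x y → + 3 ℤ.* y ℤ.+ + 1 ℤ.+ (+ 3 ℤ.* x ℤ.+ + 1) ≡ + 3 ℤ.* (x ℤ.+ y) ℤ.+ + 2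
  sum′ = solve-∀
  partner : ∀ x y → + 3 ℤ.* x ℤ.+ + 1 ℤ.+ + 16 ℤ.* (+ 3 ℤ.* y ℤ.+ + 1) ≡ + 3 ℤ.* (x ℤ.+ + 16 ℤ.* y) ℤ.+ + 17
  partner = solve-∀
  difference : ∀ x y → + 3 ℤ.* (x ℤ.+ y) ℤ.+ + 2 ℤ.+ ℤ.- (+ 3 ℤ.* y ℤ.+ + 1) ≡ + 3 ℤ.* x ℤ.+ + 1
  difference = solve-∀
  partner′ : ∀ x y → + 3 ℤ.* (x ℤ.+ y) ℤ.+ + 2 ℤ.+ + 16 ℤ.* (ℤ.- (+ 3 ℤ.* y ℤ.+ + 1)) ≡
    + 3 ℤ.* (x ℤ.- + 15 ℤ.* y) ℤ.+ ℤ.- (+ 14)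
  partner′ = solve-∀

symbols-legal : ∀ x y → Legal (wave x xor wave (x ℤ.+ 1ℤ)) (λ j → symbol j (form j x y))
symbols-legal x y = digits-rules x y ,
  trans (sym (residue-hom (argument 6F x) (argument 7F y))) (cong residue (sum x y)) ,
  (λ ≢0 → digit-unit ≢0 (is-digit 0F x)) , (λ ≢0 → digit-unit ≢0 (is-digit 1F y)) ,
  (λ ≢0 → digit-unit ≢0 (is-digit 2F (x ℤ.+ y))) ,
  trans (cong odd (residue-3 x)) (trans (odd-half (residue x))
    (cong (λ q → not (half (residue x) xor half q)) (sym (residue-hom x 1ℤ))))
  where
  sum : ∀ x y → + 3 ℤ.* x ℤ.+ + 1 ℤ.+ (+ 3 ℤ.* y ℤ.+ + 1) ≡ + 3 ℤ.* (x ℤ.+ y) ℤ.+ + 2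
  sum = solve-∀

-- Encoding the symbols by bits

bits : ℕ
bits = 9 ℕ.* 4

symbol-of : Fin bits → Symbol
symbol-of i = proj₁ (Fin.remQuot {9} 4 i)

encode : Bool → (Symbol → Q) → Vec Bool (suc bits)
encode h s = h ∷ Vec.tabulate λ i →
  lookup (Inverse.to (Vec-enum 4) (s (symbol-of i))) (proj₂ (Fin.remQuot {9} 4 i))

decode : Vec Bool (suc bits) → Symbol → Q
decode b j = Inverse.from (Vec-enum 4) (Vec.tabulate λ l → lookup b (suc (Fin.combine j l)))

decode-encode : ∀ h s j → decode (encode h s) j ≡ s j
decode-encode h s j = trans (cong (Inverse.from (Vec-enum 4)) (trans
  (Vecₚ.tabulate-cong λ l → trans
    (Vecₚ.lookup∘tabulate (λ i → lookup (Inverse.to (Vec-enum 4) (s (symbol-of i))) (proj₂ (Fin.remQuot {9} 4 i)))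
      (Fin.combine j l))
    (cong (λ (k , l) → lookup (Inverse.to (Vec-enum 4) (s k)) l) (Finₚ.remQuot-combine j l)))
  (Vecₚ.tabulate∘lookup (Inverse.to (Vec-enum 4) (s j)))))
  (Inverse.inverseʳ (Vec-enum 4) refl)

legal-cong : ∀ {h s s′} → (∀ j → s j ≡ s′ j) → Legal h s → Legal h s′
legal-cong {h} {s} {s′} eq (r , clocks , a , b , c , o) =
  rules-cong (eq 0F) (eq 1F) (eq 2F) (eq 3F) (eq 4F) (eq 5F) r ,
  trans (sym (cong₂ _⊹_ (eq 6F) (eq 7F))) (trans clocks (eq 8F)) ,
  agree 6F 0F a , agree 7F 1F b , agree 8F 2F c , trans (sym (cong odd (eq 6F))) o
  where
  agree : ∀ j k → (s j ≢ 0F → s k ≡ s j) → s′ j ≢ 0F → s′ k ≡ s′ j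
  agree j k f ≢0 = trans (sym (eq k)) (trans (f (≢0 ∘ trans (sym (eq j)))) (eq j))

module F = Fields bits (direction ∘ symbol-of) (direction≢0 ∘ symbol-of)
  (λ b → Legal (lookup b zero) (decode b)) (λ b → legal? (lookup b zero) (decode b))

solution : F.Field
solution x y = encode (wave x xor wave (x ℤ.+ 1ℤ)) (λ j → symbol j (form j x y))

solution-admissible : F.Admissible solution
solution-admissible = record
  { constant = λ x y i → trans (bit _ _ i) (trans
      (cong (λ t → lookup (Inverse.to (Vec-enum 4) (symbol (symbol-of i) t)) (proj₂ (Fin.remQuot {9} 4 i)))
        (form-direction (symbol-of i) x y))
      (sym (bit x y i)))
  ; alternate = λ x y → trans (cong (wave (x ℤ.+ 1ℤ) xor_) (wave-alternate x)) (swap (wave x) (wave (x ℤ.+ 1ℤ)))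
  ; allowed = λ x y → legal-cong
      (λ j → sym (decode-encode (wave x xor wave (x ℤ.+ 1ℤ)) (λ j → symbol j (form j x y)) j)) (symbols-legal x y) }
  where
  bit : ∀ x y i → lookup (solution x y) (suc i) ≡
    lookup (Inverse.to (Vec-enum 4) (symbol (symbol-of i) (form (symbol-of i) x y))) (proj₂ (Fin.remQuot {9} 4 i))
  bit x y i = Vecₚ.lookup∘tabulate (λ i →
    lookup (Inverse.to (Vec-enum 4) (symbol (symbol-of i) (form (symbol-of i) x y))) (proj₂ (Fin.remQuot {9} 4 i))) i
  swap : ∀ b c → c xor not b ≡ not (b xor c)
  swap = from-yes (all-Bool? λ b → all-Bool? λ c → c xor not b Boolₚ.≟ not (b xor c))

no-periodic-solution : ∀ b → F.Admissible b → ∀ k → (∀ x y → b (x ℤ.+ + suc k) y ≡ b x y) → ⊥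
no-periodic-solution b adm k periodic = Forced.aperiodic (λ x y → decode (b x y)) (λ x y → lookup (b x y) zero)
  constant (F.Admissible.alternate adm) (F.Admissible.allowed adm) k (λ x y j → cong (λ c → decode c j) (periodic x y))
  where
  constant : ∀ x y j → decode (b (x ℤ.+ proj₁ (direction j)) (y ℤ.+ proj₂ (direction j))) j ≡ decode (b x y) j
  constant x y j = cong (Inverse.from (Vec-enum 4)) (Vecₚ.tabulate-cong λ l →
    subst (λ k → lookup (b (x ℤ.+ proj₁ (direction k)) (y ℤ.+ proj₂ (direction k))) (suc (Fin.combine j l)) ≡
        lookup (b x y) (suc (Fin.combine j l)))
      (cong proj₁ (Finₚ.remQuot-combine {9} {4} j l)) (F.Admissible.constant adm x y (Fin.combine j l)))

-- Periodic sets have a horizontal period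

module FiniteIndexPeriod (G₀ : FiniteAbelianGroup) where
  open System G₀
  private
    module G₀ = FiniteAbelianGroup G₀
    module ∙ = AbelianGroup ambient

  horizontal : ℕ → G
  horizontal n = + n , 0ℤ , G₀.ε

  horizontal-+ : ∀ m n → horizontal (m ℕ.+ n) ≡ horizontal m +ᴳ horizontal n
  horizontal-+ m n = cong (λ x → + (m ℕ.+ n) , 0ℤ , x) (sym (AbelianGroup.identityˡ (strict G₀) G₀.ε))

  slide : ∀ g d r → (g +ᴳ d) -ᴳ r ≡ (g -ᴳ r) +ᴳ d
  slide g d r = trans (∙.assoc g d (-ᴳ r)) (trans (cong (g +ᴳ_) (∙.comm d (-ᴳ r))) (sym (∙.assoc g (-ᴳ r) d)))

  cancel-left : ∀ g d → (g +ᴳ d) -ᴳ g ≡ d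
  cancel-left g d = trans (cong (_-ᴳ g) (∙.comm g d)) (trans (∙.assoc d g (-ᴳ g))
    (trans (cong (d +ᴳ_) (∙.inverseʳ g)) (∙.identityʳ d)))

  -- Among the multiples 0, ..., |R| of the horizontal unit vector, two have the same representative
  -- in R, and their difference lies in H.
  subgroup-period : ∀ {H} → IsSubgroup H → FiniteIndex H → ∃[ n ] H (horizontal (suc n))
  subgroup-period {H} (_ , closed , inverse) (R , cosets)
    with Finₚ.pigeonhole (ℕₚ.n<1+n (length R)) (λ i → index (proj₁ (proj₂ (cosets (horizontal (toℕ i))))))
  ... | i , j , i<j , same with ℕₚ.m≤n⇒∃[o]m+o≡n i<j
  ... | n , 1+i+n≡j = n , subst H difference (closed _ _ (proj₂ (proj₂ (cosets (horizontal (toℕ j)))))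
          (inverse _ (proj₂ (proj₂ (cosets (horizontal (toℕ i)))))))
    where
    r : ∀ k → G
    r k = proj₁ (cosets (horizontal k))
    same-coset : r (toℕ j) ≡ r (toℕ i)
    same-coset = trans (lookup-index (proj₁ (proj₂ (cosets (horizontal (toℕ j))))))
      (trans (cong (List.lookup R) (sym same)) (sym (lookup-index (proj₁ (proj₂ (cosets (horizontal (toℕ i))))))))
    difference : (horizontal (toℕ j) -ᴳ r (toℕ j)) -ᴳ (horizontal (toℕ i) -ᴳ r (toℕ i)) ≡ horizontal (suc n)
    difference = begin
      (horizontal (toℕ j) -ᴳ r (toℕ j)) -ᴳ (horizontal (toℕ i) -ᴳ r (toℕ i))
        ≡⟨ cong₂ (λ k s → (horizontal k -ᴳ s) -ᴳ (horizontal (toℕ i) -ᴳ r (toℕ i)))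
             (trans (sym 1+i+n≡j) (sym (ℕₚ.+-suc (toℕ i) n))) same-coset ⟩
      (horizontal (toℕ i ℕ.+ suc n) -ᴳ r (toℕ i)) -ᴳ (horizontal (toℕ i) -ᴳ r (toℕ i))
        ≡⟨ cong (λ g → (g -ᴳ r (toℕ i)) -ᴳ (horizontal (toℕ i) -ᴳ r (toℕ i))) (horizontal-+ (toℕ i) (suc n)) ⟩
      ((horizontal (toℕ i) +ᴳ horizontal (suc n)) -ᴳ r (toℕ i)) -ᴳ (horizontal (toℕ i) -ᴳ r (toℕ i))
        ≡⟨ cong (_-ᴳ (horizontal (toℕ i) -ᴳ r (toℕ i))) (slide (horizontal (toℕ i)) (horizontal (suc n)) (r (toℕ i))) ⟩
      ((horizontal (toℕ i) -ᴳ r (toℕ i)) +ᴳ horizontal (suc n)) -ᴳ (horizontal (toℕ i) -ᴳ r (toℕ i))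
        ≡⟨ cancel-left (horizontal (toℕ i) -ᴳ r (toℕ i)) (horizontal (suc n)) ⟩
      horizontal (suc n) ∎
      where open ≡-Reasoning

  periodic⇒horizontally : ∀ {A} → Periodic A → HorizontallyPeriodic A
  periodic⇒horizontally {A} (H , subgroup , finite , L , cosets) with subgroup-period {H} subgroup finite
  ... | n , d∈H = n , λ g g∈A → let (r , r∈L , h) = proj₁ (cosets g) g∈A in
    proj₂ (cosets (g +ᴳ horizontal (suc n))) (r , r∈L ,
      subst H (sym (slide g (horizontal (suc n)) r)) (proj₁ (proj₂ subgroup) _ _ h d∈H))

  nonempty-aperiodic : ∀ {F} → AperiodicSystem (F ∷ []) → F ≢ [] × Aperiodic F
  nonempty-aperiodic {F} ((A , t ∷ []) , aperiodic) = nonempty , (A , t) ,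
    λ A′ t′ periodic → aperiodic A′ (t′ ∷ []) (periodic⇒horizontally {A′} periodic)
    where
    nonempty : F ≢ []
    nonempty refl with proj₁ t 0ᴳ
    ... | _ , _ , _ , () , _

theorem1p3 : ∃[ G₀ ] ∃[ F ] (F ≢ [] × Ambient.Aperiodic G₀ F)
theorem1p3 =
  let (G₀ , F , system) = F.aperiodic-tile solution-admissible wave wave-alternate (λ _ _ → refl) no-periodic-solution
  in G₀ , F , FiniteIndexPeriod.nonempty-aperiodic G₀ system
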